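{- Let $G=(V,E)$ be a planar graph of girth at least $8$. Then a set $E'\subseteq E$ with $|E'|=3$ such that $\gamma(G-E')>\gamma(G)$ can be found in polynomial time.
   Context: All graphs are finite, simple and undirected. A set $S\subseteq V(G)$ is a dominating set of a graph $G$ if every vertex of $G$ is in $S$ or is adjacent to an element of $S$; $\gamma(G)$ denotes the minimum cardinality of a dominating set of $G$. For $E'\subseteq E$, $G-E'=(V,E\setminus E')$. The girth of $G$ is the minimum length of an induced cycle of $G$, and is $+\infty$ if $G$ is acyclic.
   Formalization: The graph is assumed to have at least three edges, since otherwise no E' ⊆ E with |E'| = 3 exists (for example K2); planar means having a combinatorial embedding of genus 0. -}

module Defs where

open import Data.Bool.Base using (Bool; true; false; T; _∧_; not; if_then_else_)
open import Data.Bool.Properties using (∧-comm; T?)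
open import Data.Empty using (⊥-elim)
open import Data.Fin.Base using (Fin; toℕ; fromℕ<; remQuot)
import Data.Fin.Base as Fin
import Data.Fin.Properties as Fin
open import Data.Fin.Subset using (Subset; _∈_; ∣_∣; ⊤)
open import Data.Fin.Subset.Properties using (_∈?_; ∈⊤; anySubset?)
open import Data.List.Base using (List; length; filter; allFin; cartesianProduct; lookup)
import Data.List.Membership.DecPropositional as DecMembership
open import Data.List.Relation.Binary.Subset.Propositional using (_⊆_)
open import Data.List.Relation.Unary.Unique.Propositional using (Unique)
open import Data.Nat.Base
  using (ℕ; zero; suc; _+_; _*_; _∸_; _^_; _≤_; _<_; _>_; z≤n; s≤s)
open import Data.Nat.GeneralisedArithmetic using (iterate)
open import Data.Nat.Properties using (_≟_; _<?_)
open import Data.Product.Base using (Σ; Σ-syntax; ∃; ∃-syntax; _×_; _,_; proj₁; proj₂; uncurry)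
open import Data.Product.Properties using (≡-dec)
open import Data.Sum.Base using (_⊎_; inj₁)
open import Function.Base using (_∘_)
open import Function.Bundles using (_⇔_; _↔_; module Inverse)
open import Function.Definitions using (Injective; Surjective)
open import Relation.Binary.Construct.Add.Supremum.NonStrict (_≤_) using (_≤⁺_)
open import Relation.Binary.Construct.Closure.ReflexiveTransitive using (Star)
open import Relation.Binary.Core using (Rel)
open import Relation.Binary.Definitions using (DecidableEquality)
open import Relation.Binary.PropositionalEquality
  using (_≡_; _≢_; refl; cong₂; subst)
open import Relation.Nullary.Construct.Add.Supremum using (_⁺; ⊤⁺; [_])
open import Relation.Nullary.Decidable using (Dec; yes; no; does; ¬?; _×-dec_; _⊎-dec_)
open import Relation.Nullary.Negation using (¬_)
open import Relation.Unary using (Pred; Decidable)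

record Graph (n : ℕ) : Set where
  field
    adj       : Fin n → Fin n → Bool
    symmetric : ∀ u v → adj u v ≡ adj v u
    loopless  : ∀ v → adj v v ≡ false

  Adj : Fin n → Fin n → Set
  Adj u v = T (adj u v)

  Adj? : ∀ u v → Dec (Adj u v)
  Adj? u v = T? (adj u v)

open Graph public

-- An undirected edge {u , v} is represented by the pair (u , v) with u < v;
-- a set of edges by a duplicate-free list of such pairs.

Pair : ℕ → Set
Pair n = Fin n × Fin n

_≟ᵖ_ : ∀ {n} → DecidableEquality (Pair n)
_≟ᵖ_ = ≡-dec Fin._≟_ Fin._≟_

IsEdge : ∀ {n} → Graph n → Pair n → Set
IsEdge G (u , v) = u Fin.< v × Adj G u v

isEdge? : ∀ {n} (G : Graph n) → Decidable (IsEdge G)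
isEdge? G (u , v) = (u Fin.<? v) ×-dec Adj? G u v

E : ∀ {n} → Graph n → List (Pair n)
E {n} G = filter (isEdge? G) (cartesianProduct (allFin n) (allFin n))

-- Both orientations are removed, so the result does not depend on how
-- the edges in the list are oriented.

_─_ : ∀ {n} → Graph n → List (Pair n) → Graph n
_─_ {n} G E′ = record
  { adj       = λ u v → adj G u v ∧ (kept u v ∧ kept v u)
  ; symmetric = λ u v → cong₂ _∧_ (symmetric G u v) (∧-comm (kept u v) (kept v u))
  ; loopless  = λ v → cong₂ _∧_ (loopless G v) refl
  }
  where
  kept : Fin n → Fin n → Bool
  kept u v = not (does (DecMembership._∈?_ _≟ᵖ_ (u , v) E′))

Dominating : ∀ {n} → Graph n → Subset n → Set
Dominating G S = ∀ v → v ∈ S ⊎ (∃[ w ] w ∈ S × Adj G v w)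

dominating? : ∀ {n} (G : Graph n) → Decidable (Dominating G)
dominating? G S =
  Fin.all? λ v → (v ∈? S) ⊎-dec Fin.any? λ w → (w ∈? S) ×-dec Adj? G v w

IsMinimum : (ℕ → Set) → ℕ → Set
IsMinimum P m = P m × (∀ k → P k → m ≤ k)

minimum : ∀ {P : ℕ → Set} → Decidable P → ∃ P → ∃ (IsMinimum P)
minimum {P} P? (k , pk) = search P? k pk
  where
  search : ∀ {Q : ℕ → Set} → Decidable Q → ∀ k → Q k → ∃ (IsMinimum Q)
  search Q? k qk with Q? 0
  ... | yes q0 = 0 , q0 , λ _ _ → z≤n
  search Q? zero    qk | no ¬q0 = ⊥-elim (¬q0 qk)
  search Q? (suc k) qk | no ¬q0 with search (Q? ∘ suc) k qk
  ... | m , qm , least = suc m , qm , λ where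
    zero    q0 → ⊥-elim (¬q0 q0)
    (suc j) qj → s≤s (least j qj)

HasDominatingSetOfSize : ∀ {n} → Graph n → ℕ → Set
HasDominatingSetOfSize {n} G k = ∃[ S ] Dominating {n} G S × ∣ S ∣ ≡ k

γ-minimum : ∀ {n} (G : Graph n) → ∃ (IsMinimum (HasDominatingSetOfSize G))
γ-minimum {n} G = minimum
  (λ k → anySubset? λ S → dominating? G S ×-dec (∣ S ∣ ≟ k))
  (∣ ⊤ {n} ∣ , ⊤ , (λ _ → inj₁ ∈⊤) , refl)

γ : ∀ {n} → Graph n → ℕ
γ G = proj₁ (γ-minimum G)

CyclicSuccessor : ∀ {k} → Fin k → Fin k → Set
CyclicSuccessor {k} i j = suc (toℕ i) ≡ toℕ j ⊎ (suc (toℕ i) ≡ k × toℕ j ≡ 0)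

IsCycle : ∀ {n} → Graph n → (k : ℕ) → (Fin k → Fin n) → Set
IsCycle G k c =
  3 ≤ k × Injective _≡_ _≡_ c × (∀ i j → CyclicSuccessor i j → Adj G (c i) (c j))

IsInducedCycle : ∀ {n} → Graph n → (k : ℕ) → (Fin k → Fin n) → Set
IsInducedCycle G k c =
  IsCycle G k c ×
  (∀ i j → Adj G (c i) (c j) → CyclicSuccessor i j ⊎ CyclicSuccessor j i)

Acyclic : ∀ {n} → Graph n → Set
Acyclic G = ∀ k c → ¬ IsCycle G k c

IsGirth : ∀ {n} → Graph n → ℕ ⁺ → Set
IsGirth G [ g ] = IsMinimum (λ k → ∃ (IsInducedCycle G k)) g
IsGirth G ⊤⁺    = Acyclic G

GirthAtLeast : ℕ → ∀ {n} → Graph n → Set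
GirthAtLeast k G = ∃[ g ] IsGirth G g × [ k ] ≤⁺ g

-- Planarity, as the existence of a combinatorial embedding (rotation
-- system) all of whose components have genus 0.

Dart : ∀ {n} → Graph n → Set
Dart {n} G = Σ[ (u , v) ∈ Pair n ] Adj G u v

source : ∀ {n} {G : Graph n} → Dart G → Fin n
source ((u , _) , _) = u

reverse : ∀ {n} {G : Graph n} → Dart G → Dart G
reverse {G = G} ((u , v) , uv) = (v , u) , subst T (symmetric G u v) uv

SameOrbit : ∀ {A : Set} → (A → A) → Rel A _
SameOrbit f x y = ∃[ k ] iterate f x k ≡ y

-- For a permutation of a finite set (and for reachability in an
-- undirected graph) the relations R used below are equivalences.

HasClasses : ∀ {A : Set} → Rel A _ → ℕ → Set
HasClasses {A} R k =
  Σ[ class ∈ (A → Fin k) ]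
    Surjective _≡_ _≡_ class × (∀ x y → (class x ≡ class y) ⇔ R x y)

record RotationSystem {n : ℕ} (G : Graph n) : Set where
  field
    rotation        : Dart G ↔ Dart G
    rotation-source : ∀ d → source {G = G} (Inverse.to rotation d) ≡ source {G = G} d
    rotation-cyclic : ∀ d d′ → source {G = G} d ≡ source {G = G} d′ →
                      SameOrbit (Inverse.to rotation) d d′

  -- The orbits of this permutation are the facial walks.
  nextOnFace : Dart G → Dart G
  nextOnFace d = Inverse.to rotation (reverse {G = G} d)

Isolated : ∀ {n} → Graph n → Fin n → Set
Isolated G v = ∀ w → ¬ Adj G v w

isolated? : ∀ {n} (G : Graph n) → Decidable (Isolated G)
isolated? G v = Fin.all? λ w → ¬? (Adj? G v w)

-- A component with V vertices, E ≥ 1 edges, F facial walks and genus g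
-- has V - E + F = 2 - 2g.  An isolated vertex carries no dart, so its
-- single face has to be added by hand.  As every g is nonnegative, the
-- sum of these formulas over all components is the equation below
-- exactly when every g is 0.

record PlanarEmbedding {n : ℕ} (G : Graph n) : Set where
  field
    rotationSystem : RotationSystem G
  open RotationSystem rotationSystem public
  field
    #faces      : ℕ
    faces       : HasClasses (SameOrbit nextOnFace) #faces
    #components : ℕ
    components  : HasClasses (Star (Adj G)) #components
    genus-zero  : n + (#faces + length (filter (isolated? G) (allFin n)))
                  ≡ 2 * #components + length (E G)

Planar : ∀ {n} → Graph n → Set
Planar G = PlanarEmbedding G

-- Polynomial time, on a unit-cost random access machine with structured
-- control flow.  A program mentions finitely many registers; the memory
-- is addressed indirectly.  The arithmetic is addition and truncated
-- subtraction only, so t steps increase the bit length of the stored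
-- numbers by at most O(t), and polynomial time here agrees with polynomial
-- time on Turing machines.

Reg : Set
Reg = ℕ

infixr 5 _⨾_

data Program : Set where
  skip        : Program
  _≔_         : Reg → ℕ → Program              -- r := constant
  _≔_⊕_       : Reg → Reg → Reg → Program      -- r := a + b
  _≔_⊖_       : Reg → Reg → Reg → Program      -- r := a ∸ b
  load_from_  : Reg → Reg → Program            -- r := memory[a]
  store_at_   : Reg → Reg → Program            -- memory[a] := r
  _⨾_         : Program → Program → Program
  if_≠0_else_ : Reg → Program → Program → Program
  while_≠0_   : Reg → Program → Program

record State : Set where
  constructor ⟨_,_⟩
  field
    reg    : Reg → ℕ
    memory : ℕ → ℕ

open State public

_[_↦_] : (ℕ → ℕ) → ℕ → ℕ → (ℕ → ℕ)
(f [ i ↦ x ]) j = if does (j ≟ i) then x else f j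

-- p , s ⇓[ t ] s′: started in s, the program p halts in s′ after t steps.

infix 4 _,_⇓[_]_

data _,_⇓[_]_ : Program → State → ℕ → State → Set where
  ⇓skip  : ∀ {s} → skip , s ⇓[ 1 ] s
  ⇓const : ∀ {s r k} →
           (r ≔ k) , s ⇓[ 1 ] ⟨ reg s [ r ↦ k ] , memory s ⟩
  ⇓add   : ∀ {s r a b} →
           (r ≔ a ⊕ b) , s ⇓[ 1 ] ⟨ reg s [ r ↦ reg s a + reg s b ] , memory s ⟩
  ⇓sub   : ∀ {s r a b} →
           (r ≔ a ⊖ b) , s ⇓[ 1 ] ⟨ reg s [ r ↦ reg s a ∸ reg s b ] , memory s ⟩
  ⇓load  : ∀ {s r a} →
           (load r from a) , s ⇓[ 1 ] ⟨ reg s [ r ↦ memory s (reg s a) ] , memory s ⟩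
  ⇓store : ∀ {s r a} →
           (store r at a) , s ⇓[ 1 ] ⟨ reg s , memory s [ reg s a ↦ reg s r ] ⟩
  ⇓seq   : ∀ {p q s s′ s″ t t′} →
           p , s ⇓[ t ] s′ → q , s′ ⇓[ t′ ] s″ → (p ⨾ q) , s ⇓[ t + t′ ] s″
  ⇓then  : ∀ {r p q s s′ t} → reg s r ≢ 0 →
           p , s ⇓[ t ] s′ → (if r ≠0 p else q) , s ⇓[ 1 + t ] s′
  ⇓else  : ∀ {r p q s s′ t} → reg s r ≡ 0 →
           q , s ⇓[ t ] s′ → (if r ≠0 p else q) , s ⇓[ 1 + t ] s′
  ⇓loop  : ∀ {r p s s′ s″ t t′} → reg s r ≢ 0 →
           p , s ⇓[ t ] s′ → (while r ≠0 p) , s′ ⇓[ t′ ] s″ →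
           (while r ≠0 p) , s ⇓[ 1 + (t + t′) ] s″
  ⇓exit  : ∀ {r p s} → reg s r ≡ 0 → (while r ≠0 p) , s ⇓[ 1 ] s

-- Register 0 holds n, and memory cell u * n + v holds the (u , v) entry
-- of the adjacency matrix.  Everything else is 0.

inputState : ∀ {n} → Graph n → State
inputState {n} G = ⟨ (λ _ → 0) [ 0 ↦ n ] , matrix ⟩
  where
  matrix : ℕ → ℕ
  matrix i with i <? n * n
  ... | yes i<n² = if uncurry (adj G) (remQuot n (fromℕ< i<n²)) then 1 else 0
  ... | no  _    = 0

-- Register 0 holds the length of the list, and memory cells 2i and 2i+1
-- hold the endpoints of its i-th pair.

Outputs : ∀ {n} → State → List (Pair n) → Set
Outputs s E′ =
  reg s 0 ≡ length E′ ×
  (∀ i → memory s (2 * toℕ i)     ≡ toℕ (proj₁ (lookup E′ i)) ×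
         memory s (2 * toℕ i + 1) ≡ toℕ (proj₂ (lookup E′ i)))

-- Some program finds, for every graph in the class, a set E′ ⊆ E(G)
-- with the property Goal, in time polynomial in the number of vertices.
-- Membership in the class is promised, and no witness of it is supplied
-- to the program.

EdgeSetFoundInPolynomialTime :
  (Class : ∀ {n} → Graph n → Set) →
  (Goal : ∀ {n} → Graph n → List (Pair n) → Set) → Set
EdgeSetFoundInPolynomialTime Class Goal =
  Σ[ p ∈ Program ] ∃[ c ] ∃[ d ]
    (∀ {n} (G : Graph n) → Class G →
     ∃[ t ] Σ[ s ∈ State ] Σ[ E′ ∈ List (Pair n) ]
       p , inputState G ⇓[ t ] s ×
       t ≤ c * n ^ d + c ×
       Outputs s E′ ×
       Unique E′ × E′ ⊆ E G ×
       Goal G E′)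

{-# OPTIONS --safe #-}
module Submission where

-- By Euler's formula a planar graph of girth at least 8 with an edge has
-- distinct vertices u and v at distance at most 2 with deg u + deg v ≤ 4.
-- Otherwise, cutting the excursions to leaves out of the facial walks leaves
-- at least 8 darts on each face, while a discharging argument, in which the
-- vertices of degree 1 and 2 are supplied by their neighbours, shows that the
-- graph has too many edges for this.
--
-- If w = v or w is a common neighbour of u and v, deleting the at most three
-- edges at u and v other than vw (all of them if w = v) makes u isolated and
-- leaves v no neighbour but w. A dominating set of the result contains u, and
-- v or w, and replacing u and v by w gives a smaller dominating set of G.
--
-- The program searches through all choices of three edges and u, v, w, and
-- checks this separation property instead of computing γ.

open import Defs
import Algebra.Properties.Semiring.Sum
open import Data.Bool.Base using (Bool; true; false; T; if_then_else_; not; _∧_)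
open import Data.Bool.Properties using (T-irrelevant)
open import Data.Fin using (#_)
open import Data.Fin.Base as Fin using (Fin; zero; suc; toℕ; fromℕ<; combine; remQuot)
import Data.Fin.Properties as Fin
open import Data.Fin.Subset using (Subset; _∈_; ∣_∣; _∪_; _-_; ⁅_⁆)
open import Data.Fin.Subset.Properties
  using (_∈?_; p⊆q⇒∣p∣≤∣q∣; x∈p⇒∣p-x∣<∣p∣; x∈p∧x≢y⇒x∈p-y; p─q⊆p; x∈p∪q⁻; x∈p∪q⁺;
         x∈⁅x⁆; x∈⁅y⁆⇒x≡y; ∣⁅x⁆∣≡1)
open import Data.List.Base as List
  using (List; []; _∷_; _++_; length; allFin; filter; map; cartesianProduct; deduplicate; tabulate)
import Data.List.Membership.DecPropositional as DecMembership
open import Data.List.Membership.Propositional using (find; lose) renaming (_∈_ to _∈ˡ_; _∉_ to _∉ˡ_)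
open import Data.List.Membership.Propositional.Properties
  using (∈-filter⁺; ∈-filter⁻; ∈-cartesianProduct⁺; ∈-allFin; ∈-lookup; ∈-map⁺; ∈-map⁻;
         ∈-++⁺ˡ; ∈-++⁺ʳ; ∈-++⁻; ∈-deduplicate⁺; ∈-deduplicate⁻)
import Data.List.Membership.Setoid.Properties as SetoidMembership
open import Data.List.Properties using (length-++; length-map; filter-++; filter-notAll; map-tabulate)
open import Data.List.Relation.Binary.Subset.Propositional using (_⊆_)
open import Data.List.Relation.Unary.All as All using ([]; _∷_)
open import Data.List.Relation.Unary.All.Properties using (¬Any⇒All¬; ¬All⇒Any¬)
open import Data.List.Relation.Unary.AllPairs using ([]; _∷_)
open import Data.List.Relation.Unary.Any using (here; there)
import Data.List.Relation.Unary.Unique.DecPropositional.Properties as DecUnique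
open import Data.List.Relation.Unary.Unique.Propositional using (Unique)
import Data.List.Relation.Unary.Unique.Propositional.Properties as Unique
open import Data.Nat.Base hiding (∣_-_∣)
open import Data.Nat.GeneralisedArithmetic using (fold; fold-+; iterate)
open import Data.Nat.Induction using (<-rec)
open import Data.Nat.Properties
open import Data.Nat.Tactic.RingSolver using (solve-∀)
open import Data.Product.Base using (Σ-syntax; ∃; ∃-syntax; _×_; _,_; proj₁; proj₂; uncurry)
open import Data.Product.Properties using (,-injective)
open import Data.Sum.Base using (_⊎_; inj₁; inj₂; [_,_]′)
open import Data.Unit.Base using (⊤; tt)
open import Data.Vec.Base using (Vec; []; _∷_; lookup)
open import Function.Base using (_∘_; case_of_)
open import Function.Bundles using (module Equivalence; module Inverse)
open import Function.Definitions using (Injective)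
open import Relation.Binary.Construct.Add.Supremum.NonStrict (_≤_) using ([_])
open import Relation.Binary.Construct.Closure.ReflexiveTransitive using (Star; ε; _◅_)
open import Relation.Binary.Definitions using (DecidableEquality; tri<; tri≈; tri>)
open import Relation.Binary.PropositionalEquality hiding ([_])
open import Relation.Nullary.Construct.Add.Supremum using (⊤⁺; [_])
open import Relation.Nullary.Decidable
  using (Dec; yes; no; does; dec-true; dec-false; decidable-stable; ¬?; _×-dec_; _⊎-dec_)
open import Relation.Nullary.Negation using (¬_; contradiction)
open import Relation.Unary using (Decidable)
open Algebra.Properties.Semiring.Sum +-*-semiring
  using (sum; sum-cong-≗; ∑-distrib-+; ∑-comm; *-distribˡ-sum; *-distribʳ-sum)

-- Polynomial bounds

-- Computing `γ` is NP-hard in general, whereas a separating triple of edges is a local witness: it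
-- is checked on the adjacency matrix with a fixed number of vertex quantifiers. A set of three
-- edges has to exist at all, hence the condition on `E G` in the class.
--
-- Leaves are the obstacle to the usual Euler argument: a facial walk turns back at a leaf, and then
-- the girth does not bound its length. Without a light pair the neighbour of a leaf has degree at
-- least 4 and no second leaf, so that cutting out the excursion leaves a walk without backtracking.
--
-- The constants come from one balance. With M edges, F faces, L leaves, I isolated vertices and C
-- components, eight core darts per face give 8F ≤ 2M - 2L. Together with 8n ≤ 6M + 2L + 8I and I <
-- C this contradicts Euler's formula times 8. So each vertex starts the discharging with three
-- times its degree, 6M in all, and should end with 8; a leaf may stop at 6, because its two darts
-- are missing from the face count.

-- Powers of n + 1 ≥ 1 are monotone in the exponent, which makes
-- these bounds closed under addition.
PolynomiallyBounded : (ℕ → ℕ) → Set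
PolynomiallyBounded f = ∃[ c ] ∃[ d ] ∀ n → f n ≤ c * suc n ^ d

const-bounded : ∀ c → PolynomiallyBounded (λ _ → c)
const-bounded c = c , 0 , λ _ → ≤-reflexive (sym (*-identityʳ c))

id-bounded : PolynomiallyBounded (λ n → n)
id-bounded = 1 , 1 , λ n →
  ≤-trans (n≤1+n n) (≤-reflexive (sym (trans (*-identityˡ _) (^-identityʳ (suc n)))))

+-bounded : ∀ {f g} → PolynomiallyBounded f → PolynomiallyBounded g →
            PolynomiallyBounded (λ n → f n + g n)
+-bounded {f} {g} (c , d , f≤) (c′ , d′ , g≤) = c + c′ , d + d′ , λ n → begin
  f n + g n                                        ≤⟨ +-mono-≤ (f≤ n) (g≤ n) ⟩
  c * suc n ^ d + c′ * suc n ^ d′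
    ≤⟨ +-mono-≤ (*-monoʳ-≤ c (^-monoʳ-≤ (suc n) (m≤m+n d d′)))
                (*-monoʳ-≤ c′ (^-monoʳ-≤ (suc n) (m≤n+m d′ d))) ⟩
  c * suc n ^ (d + d′) + c′ * suc n ^ (d + d′)     ≡⟨ *-distribʳ-+ (suc n ^ (d + d′)) c c′ ⟨
  (c + c′) * suc n ^ (d + d′)                      ∎
  where open ≤-Reasoning

*-bounded : ∀ {f g} → PolynomiallyBounded f → PolynomiallyBounded g →
            PolynomiallyBounded (λ n → f n * g n)
*-bounded {f} {g} (c , d , f≤) (c′ , d′ , g≤) = c * c′ , d + d′ , λ n → begin
  f n * g n                             ≤⟨ *-mono-≤ (f≤ n) (g≤ n) ⟩
  (c * suc n ^ d) * (c′ * suc n ^ d′)   ≡⟨ [m*n]*[o*p]≡[m*o]*[n*p] c (suc n ^ d) c′ (suc n ^ d′) ⟩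
  (c * c′) * (suc n ^ d * suc n ^ d′)   ≡⟨ cong (c * c′ *_) (^-distribˡ-+-* (suc n) d d′) ⟨
  (c * c′) * suc n ^ (d + d′)           ∎
  where open ≤-Reasoning

*-^-distrib : ∀ m n d → (m * n) ^ d ≡ m ^ d * n ^ d
*-^-distrib m n zero    = refl
*-^-distrib m n (suc d) =
  trans (cong (m * n *_) (*-^-distrib m n d)) ([m*n]*[o*p]≡[m*o]*[n*p] m n (m ^ d) (n ^ d))

-- For positive `n` this is n + 1 ≤ 2n raised to the power `d`; the summand 1 covers `n` = 0, where
-- the power of `n` may vanish. It turns the bounds in n + 1 into the form c * n ^ d + c.
suc-^-≤ : ∀ n d → suc n ^ d ≤ 2 ^ d * n ^ d + 1
suc-^-≤ zero    d = ≤-trans (≤-reflexive (^-zeroˡ d)) (m≤n+m 1 (2 ^ d * 0 ^ d))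
suc-^-≤ (suc n) d = begin
  (2 + n) ^ d              ≤⟨ ^-monoˡ-≤ d (s≤s (≤-trans (m≤n+m (suc n) n) (+-monoʳ-≤ n (m≤m+n (suc n) 0)))) ⟩
  (2 * suc n) ^ d          ≡⟨ *-^-distrib 2 (suc n) d ⟩
  2 ^ d * suc n ^ d        ≤⟨ m≤m+n _ 1 ⟩
  2 ^ d * suc n ^ d + 1    ∎
  where open ≤-Reasoning

bounded⇒≤ : ∀ {f} → PolynomiallyBounded f → ∃[ c ] ∃[ d ] ∀ n → f n ≤ c * n ^ d + c
bounded⇒≤ {f} (c , d , f≤) = c * 2 ^ d , d , λ n → begin
  f n                              ≤⟨ f≤ n ⟩
  c * suc n ^ d                    ≤⟨ *-monoʳ-≤ c (suc-^-≤ n d) ⟩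
  c * (2 ^ d * n ^ d + 1)          ≡⟨ *-distribˡ-+ c (2 ^ d * n ^ d) 1 ⟩
  c * (2 ^ d * n ^ d) + c * 1      ≤⟨ +-mono-≤ (≤-reflexive (sym (*-assoc c (2 ^ d) (n ^ d))))
                                               (*-monoʳ-≤ c (m^n>0 2 d)) ⟩
  c * 2 ^ d * n ^ d + c * 2 ^ d    ∎
  where open ≤-Reasoning

-- Programs

Runs : Program → State → ℕ → (State → Set) → Set
Runs p s b Q = ∃[ t ] Σ[ s′ ∈ State ] (p , s ⇓[ t ] s′) × t ≤ b × Q s′

exactly : ∀ {p s t s′} → p , s ⇓[ t ] s′ → Runs p s t (_≡ s′)
exactly p⇓ = _ , _ , p⇓ , ≤-refl , refl

runs-then : ∀ {p q s b b′ Q R} → Runs p s b Q → (∀ s′ → Q s′ → Runs q s′ b′ R) →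
            Runs (p ⨾ q) s (b + b′) R
runs-then (t , s′ , p⇓ , t≤ , q) k with k s′ q
... | t′ , s″ , q⇓ , t′≤ , r = t + t′ , s″ , ⇓seq p⇓ q⇓ , +-mono-≤ t≤ t′≤ , r

runs-weaken : ∀ {p s b b′ Q R} → b ≤ b′ → (∀ {s′} → Q s′ → R s′) → Runs p s b Q → Runs p s b′ R
runs-weaken b≤b′ f (t , s′ , p⇓ , t≤ , q) = t , s′ , p⇓ , ≤-trans t≤ b≤b′ , f q

runs-if : ∀ {r p q s b Q} → (reg s r ≢ 0 → Runs p s b Q) → (reg s r ≡ 0 → Runs q s b Q) →
          Runs (if r ≠0 p else q) s (suc b) Q
runs-if {r} {s = s} f g with reg s r ≟ 0
... | no r≢0 with f r≢0
...   | t , s′ , p⇓ , t≤ , q = suc t , s′ , ⇓then r≢0 p⇓ , s≤s t≤ , q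
runs-if {r} {s = s} f g | yes r≡0 with g r≡0
...   | t , s′ , p⇓ , t≤ , q = suc t , s′ , ⇓else r≡0 p⇓ , s≤s t≤ , q

runs-loop : ∀ {r p s b b′ Q R} → reg s r ≢ 0 → Runs p s b Q →
            (∀ s′ → Q s′ → Runs (while r ≠0 p) s′ b′ R) →
            Runs (while r ≠0 p) s (1 + (b + b′)) R
runs-loop r≢0 (t , s′ , p⇓ , t≤ , q) k with k s′ q
... | t′ , s″ , w⇓ , t′≤ , r =
  1 + (t + t′) , s″ , ⇓loop r≢0 p⇓ w⇓ , s≤s (+-mono-≤ t≤ t′≤) , r

update-same : ∀ f i {x} → (f [ i ↦ x ]) i ≡ x
update-same f i rewrite dec-true (i ≟ i) refl = refl

update-other : ∀ f {i j x} → j ≢ i → (f [ i ↦ x ]) j ≡ f j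
update-other f {i} {j} j≢i rewrite dec-false (j ≟ i) j≢i = refl

-- Register 0 keeps n, register 1 receives the truth value of a test,
-- registers 2-5 are scratch space, and register 8 + k holds the variable
-- bound at depth k.

pattern order   = 0
pattern result  = 1
pattern one     = 2
pattern acc     = 3
pattern counter = 4
pattern todo    = 5

variable-reg : ∀ {k} → Fin k → Reg
variable-reg {suc k} zero    = 8 + k
variable-reg {suc k} (suc i) = variable-reg i

Assigned : ∀ {n k} → Vec (Fin n) k → State → Set
Assigned []                  s = ⊤
Assigned (_∷_ {n = k} v ρ)   s = reg s (8 + k) ≡ toℕ v × Assigned ρ s

assigned-lookup : ∀ {n k} (ρ : Vec (Fin n) k) {s} → Assigned ρ s →
                  ∀ i → reg s (variable-reg i) ≡ toℕ (lookup ρ i)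
assigned-lookup (v ∷ ρ) (eq , _) zero    = eq
assigned-lookup (v ∷ ρ) (_ , as) (suc i) = assigned-lookup ρ as i

assigned-resp : ∀ {n k} (ρ : Vec (Fin n) k) {s s′} →
                (∀ j → j < k → reg s′ (8 + j) ≡ reg s (8 + j)) → Assigned ρ s → Assigned ρ s′
assigned-resp []      eq _          = tt
assigned-resp (v ∷ ρ) eq (reg≡ , a) =
  trans (eq _ ≤-refl) reg≡ , assigned-resp ρ (λ j j<k → eq j (m≤n⇒m≤1+n j<k)) a

record Represents {n k : ℕ} (G : Graph n) (ρ : Vec (Fin n) k) (s : State) : Set where
  constructor represents
  field
    memory≡  : memory s ≡ memory (inputState G)
    order≡   : reg s order ≡ n
    assigned : Assigned ρ s

open Represents

represents-resp : ∀ {n k} {G : Graph n} {ρ : Vec (Fin n) k} {s s′} →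
                  memory s′ ≡ memory s → reg s′ order ≡ reg s order →
                  (∀ j → j < k → reg s′ (8 + j) ≡ reg s (8 + j)) →
                  Represents G ρ s → Represents G ρ s′
represents-resp m≡ o≡ v≡ r = represents (trans m≡ (memory≡ r)) (trans o≡ (order≡ r))
                                        (assigned-resp _ v≡ (assigned r))

-- Tests and searches as programs

Relation : ℕ → Set₁
Relation k = ∀ {n} → Graph n → Vec (Fin n) k → Set

-- What a successful run leaves behind is a parameter of its own: a test gives back its environment,
-- while a search also keeps the witness in the register of its loop variable.
Outcome : ℕ → Set₁
Outcome k = ∀ {n} → Graph n → Vec (Fin n) k → State → Set

-- robust is needed because a search ends by clearing its loop register.
record Finder (k : ℕ) (P : Relation k) (W : Outcome k) : Set where
  field
    program      : Program
    cost         : ℕ → ℕ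
    cost-bounded : PolynomiallyBounded cost
    robust       : ∀ {n} (G : Graph n) (ρ : Vec (Fin n) k) {s} → W G ρ s →
                   W G ρ ⟨ reg s [ todo ↦ 0 ] , memory s ⟩
    runs         : ∀ {n} (G : Graph n) (ρ : Vec (Fin n) k) s → Represents G ρ s →
                   Runs program s (cost n) λ s′ →
                     (reg s′ result ≡ 1 × W G ρ s′) ⊎
                     (reg s′ result ≡ 0 × Represents G ρ s′ × ¬ P G ρ)

True : ∀ {k} → Relation k → Outcome k
True P G ρ s = P G ρ × Represents G ρ s

Test : ∀ k → Relation k → Set
Test k P = Finder k P (True P)

true-robust : ∀ {k} (P : Relation k) {n} (G : Graph n) (ρ : Vec (Fin n) k) {s} →
              True P G ρ s → True P G ρ ⟨ reg s [ todo ↦ 0 ] , memory s ⟩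
true-robust P G ρ (p , r) = p , represents-resp refl refl (λ _ _ → refl) r

infix 6 _≡ₜ_ _<ₜ_
infix 5 ¬ₜ_
infixr 4 _∧ₜ_
infixr 3 _∨ₜ_

_<ₜ_ : ∀ {k} (i j : Fin k) → Test k (λ G ρ → lookup ρ i Fin.< lookup ρ j)
_<ₜ_ {k} i j = record
  { program      = (acc ≔ variable-reg j ⊖ variable-reg i) ⨾
                   if acc ≠0 (result ≔ 1) else (result ≔ 0)
  ; cost         = λ _ → 3
  ; cost-bounded = const-bounded 3
  ; robust       = true-robust (λ G ρ → lookup ρ i Fin.< lookup ρ j)
  ; runs         = λ G ρ s r → runs-then (exactly ⇓sub) λ where
      s′ refl →
        let difference = cong₂ _∸_ (assigned-lookup ρ (assigned r) j) (assigned-lookup ρ (assigned r) i)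
        in runs-if
          (λ ≢0 → 1 , _ , ⇓const , ≤-refl ,
             inj₁ (refl , m∸n≢0⇒n<m (≢0 ∘ trans difference) ,
                   represents-resp refl refl (λ _ _ → refl) r))
          (λ ≡0 → 1 , _ , ⇓const , ≤-refl ,
             inj₂ (refl , represents-resp refl refl (λ _ _ → refl) r ,
                   ≤⇒≯ (m∸n≡0⇒m≤n (trans (sym difference) ≡0))))
  }

-- Two numbers agree exactly when both truncated differences vanish, that is, when the sum of the
-- differences is 0.
_≡ₜ_ : ∀ {k} (i j : Fin k) → Test k (λ G ρ → lookup ρ i ≡ lookup ρ j)
_≡ₜ_ {k} i j = record
  { program      = (acc ≔ variable-reg j ⊖ variable-reg i) ⨾
                   (counter ≔ variable-reg i ⊖ variable-reg j) ⨾
                   (acc ≔ acc ⊕ counter) ⨾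
                   if acc ≠0 (result ≔ 0) else (result ≔ 1)
  ; cost         = λ _ → 5
  ; cost-bounded = const-bounded 5
  ; robust       = true-robust (λ G ρ → lookup ρ i ≡ lookup ρ j)
  ; runs         = λ G ρ s r →
      let x = lookup ρ i
          y = lookup ρ j
          r₁ : Represents G ρ ⟨ reg s [ acc ↦ reg s (variable-reg j) ∸ reg s (variable-reg i) ] , memory s ⟩
          r₁ = represents-resp refl refl (λ _ _ → refl) r
          difference = cong₂ _+_
            (cong₂ _∸_ (assigned-lookup ρ (assigned r) j) (assigned-lookup ρ (assigned r) i))
            (cong₂ _∸_ (assigned-lookup ρ (assigned r₁) i) (assigned-lookup ρ (assigned r₁) j))
      in runs-then (exactly ⇓sub) λ where
      _ refl → runs-then (exactly ⇓sub) λ where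
        _ refl → runs-then (exactly ⇓add) λ where
          _ refl → runs-if
            (λ ≢0 → 1 , _ , ⇓const , ≤-refl ,
               inj₂ (refl , represents-resp refl refl (λ _ _ → refl) r ,
                     λ x≡y → ≢0 (trans difference
                       (cong₂ _+_ (m≤n⇒m∸n≡0 (≤-reflexive (cong toℕ (sym x≡y))))
                                  (m≤n⇒m∸n≡0 (≤-reflexive (cong toℕ x≡y)))))))
            (λ ≡0 → 1 , _ , ⇓const , ≤-refl ,
               inj₁ (refl ,
                     Fin.toℕ-injective (≤-antisym
                       (m∸n≡0⇒m≤n (m+n≡0⇒n≡0 (toℕ y ∸ toℕ x) (trans (sym difference) ≡0)))
                       (m∸n≡0⇒m≤n (m+n≡0⇒m≡0 (toℕ y ∸ toℕ x) (trans (sym difference) ≡0)))) ,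
                     represents-resp refl refl (λ _ _ → refl) r))
  }

¬ₜ_ : ∀ {k} {P : Relation k} → Test k P → Test k (λ G ρ → ¬ P G ρ)
¬ₜ_ {k} {P} p = record
  { program      = P.program ⨾ if result ≠0 (result ≔ 0) else (result ≔ 1)
  ; cost         = λ n → P.cost n + 2
  ; cost-bounded = +-bounded P.cost-bounded (const-bounded 2)
  ; robust       = true-robust (λ G ρ → ¬ P G ρ)
  ; runs         = λ G ρ s r → runs-then (P.runs G ρ s r) λ where
      s′ (inj₁ (≡1 , p , r′)) → runs-if
        (λ _ → 1 , _ , ⇓const , ≤-refl ,
               inj₂ (refl , represents-resp refl refl (λ _ _ → refl) r′ , λ ¬p → ¬p p))
        (λ ≡0 → contradiction (trans (sym ≡1) ≡0) λ ())
      s′ (inj₂ (≡0 , r′ , ¬p)) → runs-if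
        (λ ≢0 → contradiction ≡0 ≢0)
        (λ _ → 1 , _ , ⇓const , ≤-refl ,
               inj₁ (refl , ¬p , represents-resp refl refl (λ _ _ → refl) r′))
  }
  where module P = Finder p

_∧ₜ_ : ∀ {k} {P Q : Relation k} → Test k P → Test k Q → Test k (λ G ρ → P G ρ × Q G ρ)
_∧ₜ_ {k} {P} {Q} p q = record
  { program      = P.program ⨾ if result ≠0 Q.program else skip
  ; cost         = λ n → P.cost n + (2 + Q.cost n)
  ; cost-bounded = +-bounded P.cost-bounded (+-bounded (const-bounded 2) Q.cost-bounded)
  ; robust       = true-robust (λ G ρ → P G ρ × Q G ρ)
  ; runs         = λ G ρ s r → runs-then (P.runs G ρ s r) λ where
      s′ (inj₁ (≡1 , p , r′)) → runs-if
        (λ _ → runs-weaken (n≤1+n _)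
          (λ where (inj₁ (≡1 , q , r″)) → inj₁ (≡1 , (p , q) , r″)
                   (inj₂ (≡0 , r″ , ¬q)) → inj₂ (≡0 , r″ , ¬q ∘ proj₂))
          (Q.runs G ρ s′ r′))
        (λ ≡0 → contradiction (trans (sym ≡1) ≡0) λ ())
      s′ (inj₂ (≡0 , r′ , ¬p)) → runs-if
        (λ ≢0 → contradiction ≡0 ≢0)
        (λ _ → 1 , _ , ⇓skip , s≤s z≤n , inj₂ (≡0 , r′ , ¬p ∘ proj₁))
  }
  where
  module P = Finder p
  module Q = Finder q

_∨ₜ_ : ∀ {k} {P Q : Relation k} → Test k P → Test k Q → Test k (λ G ρ → P G ρ ⊎ Q G ρ)
_∨ₜ_ {k} {P} {Q} p q = record
  { program      = P.program ⨾ if result ≠0 skip else Q.program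
  ; cost         = λ n → P.cost n + (2 + Q.cost n)
  ; cost-bounded = +-bounded P.cost-bounded (+-bounded (const-bounded 2) Q.cost-bounded)
  ; robust       = true-robust (λ G ρ → P G ρ ⊎ Q G ρ)
  ; runs         = λ G ρ s r → runs-then (P.runs G ρ s r) λ where
      s′ (inj₁ (≡1 , p , r′)) → runs-if
        (λ _ → 1 , _ , ⇓skip , s≤s z≤n , inj₁ (≡1 , inj₁ p , r′))
        (λ ≡0 → contradiction (trans (sym ≡1) ≡0) λ ())
      s′ (inj₂ (≡0 , r′ , ¬p)) → runs-if
        (λ ≢0 → contradiction ≡0 ≢0)
        (λ _ → runs-weaken (n≤1+n _)
          (λ where (inj₁ (≡1 , q , r″)) → inj₁ (≡1 , inj₂ q , r″)
                   (inj₂ (≡0 , r″ , ¬q)) → inj₂ (≡0 , r″ , [ ¬p , ¬q ]′))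
          (Q.runs G ρ s′ r′))
  }
  where
  module P = Finder p
  module Q = Finder q

-- Reading the adjacency matrix

memory-inputState : ∀ {n} (G : Graph n) (u v : Fin n) →
                    memory (inputState G) (toℕ u * n + toℕ v) ≡ (if adj G u v then 1 else 0)
memory-inputState {n} G u v =
  trans (entry _ (combine u v) (trans (Fin.toℕ-combine u v) (cong (_+ toℕ v) (*-comm n (toℕ u)))))
        (cong (λ (x , y) → if adj G x y then 1 else 0) (Fin.remQuot-combine u v))
  where
  entry : ∀ i (w : Fin (n * n)) → toℕ w ≡ i →
          memory (inputState G) i ≡ (if uncurry (adj G) (remQuot n w) then 1 else 0)
  entry i w refl with i <? n * n
  ... | yes i<n² = cong (λ x → if uncurry (adj G) (remQuot n x) then 1 else 0)
                        (Fin.fromℕ<-toℕ w i<n²)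
  ... | no  i≮n² = contradiction (Fin.toℕ<n w) i≮n²

-- The machine only adds and subtracts, so the row offset in the matrix is built up in `acc` by
-- repeated addition of `order`. This is why an adjacency test takes linear time.
multiplication : Program
multiplication = while counter ≠0 ((acc ≔ acc ⊕ order) ⨾ (counter ≔ counter ⊖ one))

multiplication-runs :
  ∀ {n k} {G : Graph n} {ρ : Vec (Fin n) k} c s → Represents G ρ s →
  reg s counter ≡ c → reg s one ≡ 1 →
  Runs multiplication s (1 + c * 3) λ s′ → Represents G ρ s′ × reg s′ acc ≡ reg s acc + c * n
multiplication-runs zero s r c≡ one≡ =
  1 , s , ⇓exit c≡ , ≤-refl , r , sym (+-identityʳ _)
multiplication-runs {n} (suc c) s r c≡ one≡ = runs-weaken (≤-reflexive (+-suc 3 (c * 3))) (λ x → x)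
  (runs-loop (λ ≡0 → contradiction (trans (sym c≡) ≡0) λ ())
    (exactly (⇓seq ⇓add ⇓sub))
    λ where
      _ refl → runs-weaken ≤-refl
        (λ (r′ , acc≡) → r′ , trans acc≡ (trans (cong (λ x → reg s acc + x + c * n) (order≡ r))
                                              (+-assoc (reg s acc) n (c * n))))
        (multiplication-runs c _ (represents-resp refl refl (λ _ _ → refl) r)
          (cong₂ _∸_ c≡ one≡) one≡))

adjacentₜ : ∀ {k} (i j : Fin k) → Test k (λ G ρ → Adj G (lookup ρ i) (lookup ρ j))
adjacentₜ {k} i j = record
  { program      = ((acc ≔ 0) ⨾ (one ≔ 1) ⨾ (counter ≔ variable-reg i ⊕ acc)) ⨾
                   multiplication ⨾
                   (acc ≔ acc ⊕ variable-reg j) ⨾ load result from acc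
  ; cost         = λ n → 3 + ((1 + n * 3) + 2)
  ; cost-bounded = +-bounded (const-bounded 3)
                     (+-bounded (+-bounded (const-bounded 1) (*-bounded id-bounded (const-bounded 3)))
                                (const-bounded 2))
  ; robust       = true-robust (λ G ρ → Adj G (lookup ρ i) (lookup ρ j))
  ; runs         = λ {n} G ρ s r →
      let u = lookup ρ i
          v = lookup ρ j
          r₁ : Represents G ρ ⟨ (reg s [ acc ↦ 0 ]) [ one ↦ 1 ] , memory s ⟩
          r₁ = represents-resp refl refl (λ _ _ → refl) r
      in runs-then (exactly (⇓seq ⇓const (⇓seq ⇓const ⇓add))) λ where
        _ refl → runs-then
          -- The loop runs `toℕ u` times; bounding this by `n` makes the cost independent of the
          -- environment.
          (runs-weaken (s≤s (*-monoˡ-≤ 3 (<⇒≤ (Fin.toℕ<n u)))) (λ x → x)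
            (multiplication-runs (toℕ u) _ (represents-resp refl refl (λ _ _ → refl) r)
              (trans (+-identityʳ _) (assigned-lookup ρ (assigned r₁) i)) refl))
          λ s₂ (r₂ , acc≡) →
            let entry≡ : memory s₂ (reg s₂ acc + reg s₂ (variable-reg j)) ≡
                         (if adj G u v then 1 else 0)
                entry≡ = trans (cong₂ (λ f → f) (memory≡ r₂)
                                     (cong₂ _+_ acc≡ (assigned-lookup ρ (assigned r₂) j)))
                               (memory-inputState G u v)
            in 2 , _ , ⇓seq ⇓add ⇓load , ≤-refl ,
               outcome (adj G u v) entry≡ (represents-resp refl refl (λ _ _ → refl) r₂)
  }
  where
  outcome : ∀ b {x} {R : Set} → x ≡ (if b then 1 else 0) → R →
            (x ≡ 1 × T b × R) ⊎ (x ≡ 0 × R × ¬ T b)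
  outcome true  eq r = inj₁ (eq , tt , r)
  outcome false eq r = inj₂ (eq , r , λ ())

∃ₜ : ∀ {k} {P : Relation (suc k)} {W : Outcome (suc k)} → Finder (suc k) P W →
     Finder k (λ G ρ → ∃[ v ] P G (v ∷ ρ)) (λ G ρ s → ∃[ v ] W G (v ∷ ρ) s)
∃ₜ {k} {P} {W} p = record
  -- Here `result` is 0, so the addition copies `order`; it also makes the answer negative if there
  -- is no vertex to try.
  { program      = ((x ≔ 0) ⨾ (result ≔ 0) ⨾ (todo ≔ order ⊕ result)) ⨾ loop
  ; cost         = λ n → 3 + (1 + n * (5 + P.cost n))
  ; cost-bounded = +-bounded (const-bounded 3) (+-bounded (const-bounded 1)
                     (*-bounded id-bounded (+-bounded (const-bounded 5) P.cost-bounded)))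
  ; robust       = λ G ρ (v , w) → v , P.robust G (v ∷ ρ) w
  ; runs         = λ {n} G ρ s r →
      runs-then (exactly (⇓seq ⇓const (⇓seq ⇓const ⇓add))) λ where
        _ refl → loop-runs G ρ n 0 _ refl (update-same (reg s) x)
          (trans (+-identityʳ _) (order≡ r))
          (represents-resp refl refl (λ j j<k → update-other (reg s) (<⇒≢ (+-monoʳ-< 8 j<k))) r)
          refl (λ _ ())
  }
  where
  module P = Finder p

  x : Reg
  x = 8 + k

  body loop : Program
  body = P.program ⨾
         if result ≠0 (todo ≔ 0)
                 else ((one ≔ 1) ⨾ (x ≔ x ⊕ one) ⨾ (todo ≔ order ⊖ x))
  loop = while todo ≠0 body

  loop-runs : ∀ {n} (G : Graph n) (ρ : Vec (Fin n) k) f c s →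
              c + f ≡ n → reg s x ≡ c → reg s todo ≡ f → Represents G ρ s → reg s result ≡ 0 →
              (∀ v → toℕ v < c → ¬ P G (v ∷ ρ)) →
              Runs loop s (1 + f * (5 + P.cost n)) λ s′ →
                (reg s′ result ≡ 1 × ∃[ v ] W G (v ∷ ρ) s′) ⊎
                (reg s′ result ≡ 0 × Represents G ρ s′ × ¬ (∃[ v ] P G (v ∷ ρ)))
  loop-runs G ρ zero c s c+f≡n x≡ todo≡ r result≡ none =
    1 , s , ⇓exit todo≡ , ≤-refl ,
    inj₂ (result≡ , r , λ (v , p) →
      none v (subst (toℕ v <_) (trans (sym c+f≡n) (+-identityʳ c)) (Fin.toℕ<n v)) p)
  loop-runs {n} G ρ (suc f) c s c+f≡n x≡ todo≡ r result≡ none =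
    runs-weaken (s≤s (≤-reflexive time≡)) (λ q → q)
      (runs-loop {b = P.cost n + 4} (λ ≡0 → contradiction (trans (sym todo≡) ≡0) λ ())
        (runs-then (P.runs G (v ∷ ρ) s (represents (memory≡ r) (order≡ r) (trans x≡ (sym v≡c) , assigned r)))
          λ where
            s′ (inj₁ (≡1 , w)) → runs-if {Q = Next}
              (λ _ → 1 , _ , ⇓const , s≤s z≤n , inj₁ (≡1 , refl , v , P.robust G (v ∷ ρ) w))
              (λ ≡0 → contradiction (trans (sym ≡1) ≡0) λ ())
            s′ (inj₂ (≡0 , r′ , ¬p)) → runs-if {Q = Next}
              (λ ≢0 → contradiction ≡0 ≢0)
              (λ _ → 3 , _ , ⇓seq ⇓const (⇓seq ⇓add ⇓sub) , ≤-refl ,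
                     inj₂ (≡0 , next-x s′ r′ , next-todo s′ r′ , next-represents s′ r′ , ¬p)))
        λ where
          s′ (inj₁ (≡1 , todo≡0 , w)) →
            1 , s′ , ⇓exit todo≡0 , s≤s z≤n , inj₁ (≡1 , w)
          s′ (inj₂ (≡0 , x≡′ , todo≡′ , r′ , ¬p)) →
            loop-runs G ρ f (suc c) s′ (trans (sym (+-suc c f)) c+f≡n) x≡′ todo≡′ r′ ≡0
              λ u u<1+c → case m<1+n⇒m<n∨m≡n u<1+c of λ where
                (inj₁ u<c) → none u u<c
                (inj₂ u≡c) → subst (λ v → ¬ P G (v ∷ ρ)) (Fin.toℕ-injective (trans v≡c (sym u≡c))) ¬p)
    where
    c<n : c < n
    c<n = subst (c <_) c+f≡n (m<m+n c (s≤s z≤n))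

    v : Fin n
    v = fromℕ< c<n

    v≡c : toℕ v ≡ c
    v≡c = Fin.toℕ-fromℕ< c<n

    Next : State → Set
    Next s′ = (reg s′ result ≡ 1 × reg s′ todo ≡ 0 × ∃[ v ] W G (v ∷ ρ) s′) ⊎
              (reg s′ result ≡ 0 × reg s′ x ≡ suc c × reg s′ todo ≡ f ×
               Represents G ρ s′ × ¬ P G (v ∷ ρ))

    x⁺ : ∀ s′ → Represents G (v ∷ ρ) s′ → reg s′ x + 1 ≡ suc c
    x⁺ s′ r′ = trans (+-comm _ 1) (cong suc (trans (proj₁ (assigned r′)) v≡c))

    advance : State → ℕ → ℕ
    advance s′ = (reg s′ [ one ↦ 1 ]) [ x ↦ reg s′ x + 1 ]

    next-x : ∀ s′ (r′ : Represents G (v ∷ ρ) s′) → advance s′ x ≡ suc c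
    next-x s′ r′ = trans (update-same (reg s′ [ one ↦ 1 ]) x) (x⁺ s′ r′)

    next-todo : ∀ s′ (r′ : Represents G (v ∷ ρ) s′) → reg s′ order ∸ advance s′ x ≡ f
    next-todo s′ r′ = trans (cong₂ _∸_ (trans (order≡ r′) (sym (trans (sym (+-suc c f)) c+f≡n)))
                                       (next-x s′ r′))
                            (m+n∸m≡n (suc c) f)

    next-represents : ∀ s′ → Represents G (v ∷ ρ) s′ → ∀ {y} →
                      Represents G ρ ⟨ advance s′ [ todo ↦ y ] , memory s′ ⟩
    next-represents s′ r′ =
      represents-resp refl refl (λ j j<k → update-other (reg s′ [ one ↦ 1 ]) (<⇒≢ (+-monoʳ-< 8 j<k)))
        (represents (memory≡ r′) (order≡ r′) (proj₂ (assigned r′)))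

    time-identity : ∀ p f → (p + 4) + (1 + f * (5 + p)) ≡ suc f * (5 + p)
    time-identity = solve-∀

    time≡ : (P.cost n + 4) + (1 + f * (5 + P.cost n)) ≡ suc f * (5 + P.cost n)
    time≡ = time-identity (P.cost n) f

-- Deleting edges

module _ {n : ℕ} (G : Graph n) (E′ : List (Pair n)) where

  private
    _∈ᵖ?_ : (e : Pair n) (es : List (Pair n)) → Dec (e ∈ˡ es)
    _∈ᵖ?_ = DecMembership._∈?_ _≟ᵖ_

  ─-adj⁻ : ∀ {x y} → Adj (G ─ E′) x y → Adj G x y × (x , y) ∉ˡ E′ × (y , x) ∉ˡ E′
  ─-adj⁻ {x} {y} a with adj G x y | (x , y) ∈ᵖ? E′ | (y , x) ∈ᵖ? E′
  ─-adj⁻ a | true | no ∉₁ | no ∉₂ = tt , ∉₁ , ∉₂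

  ─-adj⁺ : ∀ {x y} → Adj G x y → (x , y) ∉ˡ E′ → (y , x) ∉ˡ E′ → Adj (G ─ E′) x y
  ─-adj⁺ {x} {y} a ∉₁ ∉₂ with adj G x y | (x , y) ∈ᵖ? E′ | (y , x) ∈ᵖ? E′
  ... | true | yes ∈₁ | _      = ∉₁ ∈₁
  ... | true | no _   | yes ∈₂ = ∉₂ ∈₂
  ... | true | no _   | no _   = tt

∈E⁺ : ∀ {n} (G : Graph n) {e} → IsEdge G e → e ∈ˡ E G
∈E⁺ G = ∈-filter⁺ (isEdge? G) (∈-cartesianProduct⁺ (∈-allFin _) (∈-allFin _))

∈E⁻ : ∀ {n} (G : Graph n) {e} → e ∈ˡ E G → IsEdge G e
∈E⁻ {n} G e∈E = proj₂ (∈-filter⁻ (isEdge? G) {xs = cartesianProduct (allFin n) (allFin n)} e∈E)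

record Separates {n} (G : Graph n) (E′ : List (Pair n)) (u v w : Fin n) : Set where
  field
    u~w        : Adj G u w
    u≢v        : u ≢ v
    w≡v⊎w~v    : w ≡ v ⊎ Adj G w v
    u-isolated : ∀ x → ¬ Adj (G ─ E′) u x
    v-pendant  : ∀ x → Adj (G ─ E′) v x → x ≡ w

Adj-sym : ∀ {n} (G : Graph n) {u v} → Adj G u v → Adj G v u
Adj-sym G {u} {v} = subst T (symmetric G u v)

Adj-irrefl : ∀ {n} (G : Graph n) {u v} → Adj G u v → u ≢ v
Adj-irrefl G {u} u~u refl = subst T (loopless G u) u~u

∣p∪q∣≤∣p∣+∣q∣ : ∀ {n} (p q : Subset n) → ∣ p ∪ q ∣ ≤ ∣ p ∣ + ∣ q ∣
∣p∪q∣≤∣p∣+∣q∣ []          []          = z≤n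
∣p∪q∣≤∣p∣+∣q∣ (true ∷ p)  (true ∷ q)  =
  s≤s (≤-trans (∣p∪q∣≤∣p∣+∣q∣ p q) (+-monoʳ-≤ ∣ p ∣ (n≤1+n ∣ q ∣)))
∣p∪q∣≤∣p∣+∣q∣ (true ∷ p)  (false ∷ q) = s≤s (∣p∪q∣≤∣p∣+∣q∣ p q)
∣p∪q∣≤∣p∣+∣q∣ (false ∷ p) (true ∷ q)  =
  ≤-trans (s≤s (∣p∪q∣≤∣p∣+∣q∣ p q)) (≤-reflexive (sym (+-suc ∣ p ∣ ∣ q ∣)))
∣p∪q∣≤∣p∣+∣q∣ (false ∷ p) (false ∷ q) = ∣p∪q∣≤∣p∣+∣q∣ p q

γ-≤ : ∀ {n} (G : Graph n) {S} → Dominating G S → γ G ≤ ∣ S ∣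
γ-≤ G {S} dom = proj₂ (proj₂ (γ-minimum G)) ∣ S ∣ (S , dom , refl)

-- A dominating set of G ─ E′ contains u, and v or w; exchanging u and v
-- for w yields a smaller set, which dominates G.
separates⇒γ-increases : ∀ {n} (G : Graph n) {E′ u v w} → Separates G E′ u v w → γ (G ─ E′) > γ G
separates⇒γ-increases {n} G {E′} {u} {v} {w} sep with proj₁ (proj₂ (γ-minimum (G ─ E′)))
... | D , dom , ∣D∣≡γ = subst (γ G <_) ∣D∣≡γ (≤-<-trans (γ-≤ G dominates) (smaller w∈D⊎v∈D))
  where
  open Separates sep

  D′ : Subset n
  D′ = (D - u - v) ∪ ⁅ w ⁆

  u∈D : u ∈ D
  u∈D with dom u
  ... | inj₁ ∈D           = ∈D
  ... | inj₂ (x , _ , u~x) = contradiction u~x (u-isolated x)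

  w∈D⊎v∈D : (w ∈ D × w ≢ v) ⊎ v ∈ D
  w∈D⊎v∈D with v ∈? D
  ... | yes v∈D = inj₂ v∈D
  ... | no  v∉D with dom v
  ...   | inj₁ v∈D = contradiction v∈D v∉D
  ...   | inj₂ (x , x∈D , v~x) with v-pendant x v~x
  ...     | refl = inj₁ (x∈D , λ where refl → v∉D x∈D)

  -- If `w` is in `D`, nothing new enters and `u` leaves. If `v` is in `D`, two vertices leave and
  -- at most one enters.
  smaller : (w ∈ D × w ≢ v) ⊎ v ∈ D → ∣ D′ ∣ < ∣ D ∣
  smaller (inj₁ (w∈D , _)) = ≤-<-trans (p⊆q⇒∣p∣≤∣q∣ D′⊆D-u) (x∈p⇒∣p-x∣<∣p∣ u∈D)
    where
    D′⊆D-u : ∀ {x} → x ∈ D′ → x ∈ D - u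
    D′⊆D-u x∈D′ with x∈p∪q⁻ (D - u - v) ⁅ w ⁆ x∈D′
    ... | inj₁ x∈ = p─q⊆p (D - u) ⁅ v ⁆ x∈
    ... | inj₂ x∈ with x∈⁅y⁆⇒x≡y w x∈
    ...   | refl = x∈p∧x≢y⇒x∈p-y w∈D (Adj-irrefl G (Adj-sym G u~w))
  smaller (inj₂ v∈D) = begin-strict
    ∣ D′ ∣                       ≤⟨ ∣p∪q∣≤∣p∣+∣q∣ (D - u - v) ⁅ w ⁆ ⟩
    ∣ D - u - v ∣ + ∣ ⁅ w ⁆ ∣    ≡⟨ cong (∣ D - u - v ∣ +_) (∣⁅x⁆∣≡1 w) ⟩
    ∣ D - u - v ∣ + 1            ≡⟨ +-comm _ 1 ⟩
    suc ∣ D - u - v ∣            ≤⟨ x∈p⇒∣p-x∣<∣p∣ (x∈p∧x≢y⇒x∈p-y v∈D (u≢v ∘ sym)) ⟩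
    ∣ D - u ∣                    <⟨ x∈p⇒∣p-x∣<∣p∣ u∈D ⟩
    ∣ D ∣                        ∎
    where open ≤-Reasoning

  w∈D′ : w ∈ D′
  w∈D′ = x∈p∪q⁺ {p = D - u - v} (inj₂ (x∈⁅x⁆ w))

  kept : ∀ {x} → x ∈ D → x ≢ u → x ≢ v → x ∈ D′
  kept x∈D x≢u x≢v = x∈p∪q⁺ (inj₁ (x∈p∧x≢y⇒x∈p-y (x∈p∧x≢y⇒x∈p-y x∈D x≢u) x≢v))

  dominates : Dominating G D′
  dominates x with x Fin.≟ u | x Fin.≟ v
  ... | yes refl | _        = inj₂ (w , w∈D′ , u~w)
  ... | no _     | yes refl with w≡v⊎w~v
  ...   | inj₁ refl = inj₁ w∈D′
  ...   | inj₂ w~v  = inj₂ (w , w∈D′ , Adj-sym G w~v)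
  dominates x | no x≢u | no x≢v with dom x
  ... | inj₁ x∈D = inj₁ (kept x∈D x≢u x≢v)
  -- Losing `u` and `v` as dominators does no harm: in `G ─ E′` the vertex `u` has no neighbour, and
  -- the only possible neighbour of `v` is `w`, which is in `D′`.
  ... | inj₂ (y , y∈D , x~y) with y Fin.≟ u | y Fin.≟ v
  ...   | yes refl | _     = contradiction (Adj-sym (G ─ E′) x~y) (u-isolated x)
  ...   | no _ | yes refl  =
    inj₁ (subst (_∈ D′) (sym (v-pendant x (Adj-sym (G ─ E′) x~y))) w∈D′)
  ...   | no y≢u | no y≢v  = inj₂ (y , kept y∈D y≢u y≢v , proj₁ (─-adj⁻ G E′ x~y))

-- The search

Joins : ∀ {n} → Pair n → Fin n → Fin n → Set
Joins (a , b) x y = (x ≡ a × y ≡ b) ⊎ (x ≡ b × y ≡ a)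

Joined : ∀ {n} → Pair n → Pair n → Pair n → Fin n → Fin n → Set
Joined e₁ e₂ e₃ x y = Joins e₁ x y ⊎ Joins e₂ x y ⊎ Joins e₃ x y

Same : ∀ {n} → Pair n → Pair n → Set
Same (a , b) (c , d) = a ≡ c × b ≡ d

-- `Separates` and the conditions on the edge list, rephrased with only those connectives for which
-- there are tests: each universal statement is a negated existential, and membership of an edge in
-- the list is spelled out by `Joined`, in either orientation.
Certificate : ∀ {n} → Graph n → (e₁ e₂ e₃ : Pair n) (u v w : Fin n) → Set
Certificate G e₁ e₂ e₃ u v w =
  (IsEdge G e₁ × IsEdge G e₂ × IsEdge G e₃) ×
  (¬ Same e₁ e₂ × ¬ Same e₁ e₃ × ¬ Same e₂ e₃) ×
  Adj G u w × ¬ u ≡ v × (w ≡ v ⊎ Adj G w v) ×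
  ¬ (∃[ x ] Adj G u x × ¬ Joined e₁ e₂ e₃ u x) ×
  ¬ (∃[ x ] Adj G v x × ¬ x ≡ w × ¬ Joined e₁ e₂ e₃ v x)

pairAt : ∀ {n k} → Fin k × Fin k → Vec (Fin n) k → Pair n
pairAt (i , j) ρ = lookup ρ i , lookup ρ j

isEdgeₜ : ∀ {k} (p : Fin k × Fin k) → Test k (λ G ρ → IsEdge G (pairAt p ρ))
isEdgeₜ (i , j) = i <ₜ j ∧ₜ adjacentₜ i j

joinsₜ : ∀ {k} (p : Fin k × Fin k) (x y : Fin k) →
         Test k (λ G ρ → Joins (pairAt p ρ) (lookup ρ x) (lookup ρ y))
joinsₜ (i , j) x y = (x ≡ₜ i ∧ₜ y ≡ₜ j) ∨ₜ (x ≡ₜ j ∧ₜ y ≡ₜ i)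

joinedₜ : ∀ {k} (p q r : Fin k × Fin k) (x y : Fin k) →
          Test k (λ G ρ → Joined (pairAt p ρ) (pairAt q ρ) (pairAt r ρ) (lookup ρ x) (lookup ρ y))
joinedₜ p q r x y = joinsₜ p x y ∨ₜ joinsₜ q x y ∨ₜ joinsₜ r x y

sameₜ : ∀ {k} (p q : Fin k × Fin k) → Test k (λ G ρ → Same (pairAt p ρ) (pairAt q ρ))
sameₜ (i , j) (k , l) = i ≡ₜ k ∧ₜ j ≡ₜ l

-- A search whose witness is forgotten is a test again, and can then stand below `¬ₜ` or inside a
-- conjunction.
existsₜ : ∀ {k} {P : Relation (suc k)} → Test (suc k) P → Test k (λ G ρ → ∃[ v ] P G (v ∷ ρ))
existsₜ {P = P} p = record
  { program      = F.program
  ; cost         = F.cost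
  ; cost-bounded = F.cost-bounded
  ; robust       = true-robust (λ G ρ → ∃[ v ] P G (v ∷ ρ))
  ; runs         = λ G ρ s r → runs-weaken ≤-refl
      (λ where
        (inj₁ (≡1 , v , p , represents m≡ o≡ (_ , a))) → inj₁ (≡1 , (v , p) , represents m≡ o≡ a)
        (inj₂ (≡0 , r , ¬p))                           → inj₂ (≡0 , r , ¬p))
      (F.runs G ρ s r)
  }
  where module F = Finder (∃ₜ p)

-- The variables are bound in the order a₁, b₁, a₂, b₂, a₃, b₃, u, v, w,
-- and # i is the one bound i + 1 binders ago.
Certified : Relation 9
Certified G ρ = Certificate G (pairAt (# 8 , # 7) ρ) (pairAt (# 6 , # 5) ρ) (pairAt (# 4 , # 3) ρ)
                              (lookup ρ (# 2)) (lookup ρ (# 1)) (lookup ρ (# 0))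

certificateₜ : Test 9 Certified
certificateₜ =
  (isEdgeₜ (# 8 , # 7) ∧ₜ isEdgeₜ (# 6 , # 5) ∧ₜ isEdgeₜ (# 4 , # 3)) ∧ₜ
  (¬ₜ sameₜ (# 8 , # 7) (# 6 , # 5) ∧ₜ ¬ₜ sameₜ (# 8 , # 7) (# 4 , # 3) ∧ₜ ¬ₜ sameₜ (# 6 , # 5) (# 4 , # 3)) ∧ₜ
  adjacentₜ (# 2) (# 0) ∧ₜ ¬ₜ (# 2) ≡ₜ (# 1) ∧ₜ ((# 0) ≡ₜ (# 1) ∨ₜ adjacentₜ (# 0) (# 1)) ∧ₜ
  -- Below the binder the new vertex is `# 0` and every other index is one higher than outside.
  ¬ₜ existsₜ (adjacentₜ (# 3) (# 0) ∧ₜ ¬ₜ joinedₜ (# 9 , # 8) (# 7 , # 6) (# 5 , # 4) (# 3) (# 0)) ∧ₜ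
  ¬ₜ existsₜ (adjacentₜ (# 2) (# 0) ∧ₜ ¬ₜ (# 0) ≡ₜ (# 1) ∧ₜ
              ¬ₜ joinedₜ (# 9 , # 8) (# 7 , # 6) (# 5 , # 4) (# 2) (# 0))

joined⇒∈ : ∀ {n} {e₁ e₂ e₃ : Pair n} {x y} → Joined e₁ e₂ e₃ x y →
           (x , y) ∈ˡ e₁ ∷ e₂ ∷ e₃ ∷ [] ⊎ (y , x) ∈ˡ e₁ ∷ e₂ ∷ e₃ ∷ []
joined⇒∈ (inj₁ (inj₁ (refl , refl)))        = inj₁ (here refl)
joined⇒∈ (inj₁ (inj₂ (refl , refl)))        = inj₂ (here refl)
joined⇒∈ (inj₂ (inj₁ (inj₁ (refl , refl)))) = inj₁ (there (here refl))
joined⇒∈ (inj₂ (inj₁ (inj₂ (refl , refl)))) = inj₂ (there (here refl))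
joined⇒∈ (inj₂ (inj₂ (inj₁ (refl , refl)))) = inj₁ (there (there (here refl)))
joined⇒∈ (inj₂ (inj₂ (inj₂ (refl , refl)))) = inj₂ (there (there (here refl)))

∈⇒joined : ∀ {n} {e₁ e₂ e₃ : Pair n} {x y} → (x , y) ∈ˡ e₁ ∷ e₂ ∷ e₃ ∷ [] → Joined e₁ e₂ e₃ x y
∈⇒joined (here refl)                 = inj₁ (inj₁ (refl , refl))
∈⇒joined (there (here refl))         = inj₂ (inj₁ (inj₁ (refl , refl)))
∈⇒joined (there (there (here refl))) = inj₂ (inj₂ (inj₁ (refl , refl)))

joined-sym : ∀ {n} {e₁ e₂ e₃ : Pair n} {x y} → Joined e₁ e₂ e₃ x y → Joined e₁ e₂ e₃ y x
joined-sym (inj₁ (inj₁ (p , q)))        = inj₁ (inj₂ (q , p))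
joined-sym (inj₁ (inj₂ (p , q)))        = inj₁ (inj₁ (q , p))
joined-sym (inj₂ (inj₁ (inj₁ (p , q)))) = inj₂ (inj₁ (inj₂ (q , p)))
joined-sym (inj₂ (inj₁ (inj₂ (p , q)))) = inj₂ (inj₁ (inj₁ (q , p)))
joined-sym (inj₂ (inj₂ (inj₁ (p , q)))) = inj₂ (inj₂ (inj₂ (q , p)))
joined-sym (inj₂ (inj₂ (inj₂ (p , q)))) = inj₂ (inj₂ (inj₁ (q , p)))

certificate⁻ : ∀ {n} {G : Graph n} {e₁ e₂ e₃ u v w} → Certificate G e₁ e₂ e₃ u v w →
               let E′ = e₁ ∷ e₂ ∷ e₃ ∷ [] in Unique E′ × E′ ⊆ E G × Separates G E′ u v w
certificate⁻ {G = G} {e₁} {e₂} {e₃} {w = w}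
  ((edge₁ , edge₂ , edge₃) , (1≢2 , 1≢3 , 2≢3) , u~w , u≢v , w≡v⊎w~v , u-iso , v-pend) =
  ((1≢2 ∘ ,-injective) ∷ (1≢3 ∘ ,-injective) ∷ []) ∷ ((2≢3 ∘ ,-injective) ∷ []) ∷ [] ∷ [] ,
  (λ where (here refl)                 → ∈E⁺ G edge₁
           (there (here refl))         → ∈E⁺ G edge₂
           (there (there (here refl))) → ∈E⁺ G edge₃) ,
  record
    { u~w = u~w ; u≢v = u≢v ; w≡v⊎w~v = w≡v⊎w~v
    ; u-isolated = λ x u~x → case ─-adj⁻ G (e₁ ∷ e₂ ∷ e₃ ∷ []) u~x of λ
        (u~x , ∉₁ , ∉₂) → u-iso (x , u~x , [ ∉₁ , ∉₂ ]′ ∘ joined⇒∈)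
    ; v-pendant = λ x v~x → case ─-adj⁻ G (e₁ ∷ e₂ ∷ e₃ ∷ []) v~x of λ
        (v~x , ∉₁ , ∉₂) → decidable-stable (x Fin.≟ w) λ x≢w →
          v-pend (x , v~x , x≢w , [ ∉₁ , ∉₂ ]′ ∘ joined⇒∈)
    }

certificate⁺ : ∀ {n} {G : Graph n} {e₁ e₂ e₃ u v w} →
               let E′ = e₁ ∷ e₂ ∷ e₃ ∷ [] in Unique E′ → E′ ⊆ E G → Separates G E′ u v w →
               Certificate G e₁ e₂ e₃ u v w
certificate⁺ {G = G} {e₁} {e₂} {e₃} ((1≢2 ∷ 1≢3 ∷ []) ∷ (2≢3 ∷ []) ∷ [] ∷ []) E′⊆E sep =
  (∈E⁻ G (E′⊆E (here refl)) , ∈E⁻ G (E′⊆E (there (here refl))) , ∈E⁻ G (E′⊆E (there (there (here refl))))) ,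
  ((λ (p , q) → 1≢2 (cong₂ _,_ p q)) , (λ (p , q) → 1≢3 (cong₂ _,_ p q)) , λ (p , q) → 2≢3 (cong₂ _,_ p q)) ,
  u~w , u≢v , w≡v⊎w~v ,
  (λ (x , u~x , ¬J) → u-isolated x (remains u~x ¬J)) ,
  (λ (x , v~x , x≢w , ¬J) → x≢w (v-pendant x (remains v~x ¬J)))
  where
  open Separates sep
  remains : ∀ {x y} → Adj G x y → ¬ Joined e₁ e₂ e₃ x y → Adj (G ─ (e₁ ∷ e₂ ∷ e₃ ∷ [])) x y
  remains x~y ¬J = ─-adj⁺ G (e₁ ∷ e₂ ∷ e₃ ∷ []) x~y (¬J ∘ ∈⇒joined) (¬J ∘ joined-sym ∘ ∈⇒joined)

search : Finder 0
  (λ {n} G ρ → ∃[ a₁ ] ∃[ b₁ ] ∃[ a₂ ] ∃[ b₂ ] ∃[ a₃ ] ∃[ b₃ ] ∃[ u ] ∃[ v ] ∃[ w ]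
    Certified {n} G (w ∷ v ∷ u ∷ b₃ ∷ a₃ ∷ b₂ ∷ a₂ ∷ b₁ ∷ a₁ ∷ ρ))
  (λ {n} G ρ s → ∃[ a₁ ] ∃[ b₁ ] ∃[ a₂ ] ∃[ b₂ ] ∃[ a₃ ] ∃[ b₃ ] ∃[ u ] ∃[ v ] ∃[ w ]
    True Certified {n} G (w ∷ v ∷ u ∷ b₃ ∷ a₃ ∷ b₂ ∷ a₂ ∷ b₁ ∷ a₁ ∷ ρ) s)
search = ∃ₜ (∃ₜ (∃ₜ (∃ₜ (∃ₜ (∃ₜ (∃ₜ (∃ₜ (∃ₜ certificateₜ))))))))

-- The six endpoints were bound first, at depths 0 to 5, and therefore sit in registers 8 to 13. The
-- matrix may be overwritten, since the search is over.
write : Program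
write = ((1 ≔ 0) ⨾ (store 8 at 1) ⨾ (1 ≔ 1) ⨾ (store 9 at 1) ⨾
         (1 ≔ 2) ⨾ (store 10 at 1) ⨾ (1 ≔ 3) ⨾ (store 11 at 1) ⨾
         (1 ≔ 4) ⨾ (store 12 at 1) ⨾ (1 ≔ 5) ⨾ (store 13 at 1)) ⨾ (0 ≔ 3)

write-runs : ∀ {n} {G : Graph n} {s} a₁ b₁ a₂ b₂ a₃ b₃ u v w →
             Represents G (w ∷ v ∷ u ∷ b₃ ∷ a₃ ∷ b₂ ∷ a₂ ∷ b₁ ∷ a₁ ∷ []) s →
             Runs write s 13 λ s′ → Outputs s′ ((a₁ , b₁) ∷ (a₂ , b₂) ∷ (a₃ , b₃) ∷ [])
write-runs a₁ b₁ a₂ b₂ a₃ b₃ u v w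
  (represents _ _ (_ , _ , _ , b₃≡ , a₃≡ , b₂≡ , a₂≡ , b₁≡ , a₁≡ , tt)) =
  13 , _ ,
  ⇓seq (⇓seq ⇓const (⇓seq ⇓store (⇓seq ⇓const (⇓seq ⇓store (⇓seq ⇓const (⇓seq ⇓store
       (⇓seq ⇓const (⇓seq ⇓store (⇓seq ⇓const (⇓seq ⇓store (⇓seq ⇓const ⇓store))))))))))) ⇓const ,
  ≤-refl , refl , λ where
    zero             → a₁≡ , b₁≡
    (suc zero)       → a₂≡ , b₂≡
    (suc (suc zero)) → a₃≡ , b₃≡

-- The finder halts on every graph; on the promised class its negative answer contradicts `found`,
-- so only the successful branch has to be continued by `p`.
find-then : ∀ {Class : ∀ {n} → Graph n → Set} {Goal : ∀ {n} → Graph n → List (Pair n) → Set}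
            {P : Relation 0} {W : Outcome 0} → Finder 0 P W →
            (∀ {n} (G : Graph n) → Class G → P G []) →
            ∀ p b → (∀ {n} (G : Graph n) s → W G [] s → Runs p s b λ s′ →
                       Σ[ E′ ∈ List (Pair n) ] Outputs s′ E′ × Unique E′ × E′ ⊆ E G × Goal G E′) →
            EdgeSetFoundInPolynomialTime Class Goal
find-then {Class} {Goal} {P} {W} finder found p b finish
  with c , d , cost≤ ← bounded⇒≤ (+-bounded (Finder.cost-bounded finder) (const-bounded b))
  = Finder.program finder ⨾ p , c , d , bounded-run
  where
  bounded-run : ∀ {n} (G : Graph n) → Class G → ∃[ t ] Σ[ s ∈ State ] Σ[ E′ ∈ List (Pair n) ]
                (Finder.program finder ⨾ p) , inputState G ⇓[ t ] s × t ≤ c * n ^ d + c ×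
                Outputs s E′ × Unique E′ × E′ ⊆ E G × Goal G E′
  bounded-run {n} G G∈Class
    with runs-then (Finder.runs finder G [] (inputState G) (represents refl refl tt))
           (λ where s (inj₁ (_ , w))        → finish G s w
                    s (inj₂ (_ , _ , none)) → contradiction (found G G∈Class) none)
  ... | t , s , p⇓ , t≤ , E′ , outcome = t , s , E′ , p⇓ , ≤-trans t≤ (cost≤ n) , outcome

separation⇒polynomial-time :
  (Class : ∀ {n} → Graph n → Set) →
  (∀ {n} (G : Graph n) → Class G →
     ∃[ e₁ ] ∃[ e₂ ] ∃[ e₃ ] ∃[ u ] ∃[ v ] ∃[ w ]
       let E′ = e₁ ∷ e₂ ∷ e₃ ∷ [] in Unique E′ × E′ ⊆ E G × Separates G E′ u v w) →
  EdgeSetFoundInPolynomialTime Class (λ G E′ → length E′ ≡ 3 × γ (G ─ E′) > γ G)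
separation⇒polynomial-time Class separation = find-then {Class = Class} {Goal = λ G E′ → length E′ ≡ 3 × γ (G ─ E′) > γ G} search
  (λ G G∈Class →
    let (a₁ , b₁) , (a₂ , b₂) , (a₃ , b₃) , u , v , w , unique , E′⊆E , separates = separation G G∈Class
    in a₁ , b₁ , a₂ , b₂ , a₃ , b₃ , u , v , w , certificate⁺ unique E′⊆E separates)
  write 13
  λ G s (a₁ , b₁ , a₂ , b₂ , a₃ , b₃ , u , v , w , certified , r) →
    let unique , E′⊆E , separates = certificate⁻ certified
    in runs-weaken ≤-refl
         (λ outputs → _ , outputs , unique , (λ {x} → E′⊆E {x}) , refl , separates⇒γ-increases G separates)
         (write-runs a₁ b₁ a₂ b₂ a₃ b₃ u v w r)

-- Light pairs

module _ {A : Set} where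

  injective⇒≤-length : ∀ {m} {f : Fin m → A} {ys} → Injective _≡_ _≡_ f → (∀ i → f i ∈ˡ ys) → m ≤ length ys
  injective⇒≤-length inj f∈ys =
    Fin.injective⇒≤ λ eq → inj (SetoidMembership.index-injective (setoid A) (f∈ys _) (f∈ys _) eq)

  unique⇒lookup-injective : ∀ {xs : List A} → Unique xs → Injective _≡_ _≡_ (List.lookup xs)
  unique⇒lookup-injective {x ∷ xs} (x∉ ∷ uniq) {zero}  {zero}  eq = refl
  unique⇒lookup-injective {x ∷ xs} (x∉ ∷ uniq) {zero}  {suc j} eq =
    contradiction eq (All.lookup x∉ (∈-lookup j))
  unique⇒lookup-injective {x ∷ xs} (x∉ ∷ uniq) {suc i} {zero}  eq =
    contradiction (sym eq) (All.lookup x∉ (∈-lookup i))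
  unique⇒lookup-injective {x ∷ xs} (x∉ ∷ uniq) {suc i} {suc j} eq =
    cong suc (unique⇒lookup-injective uniq eq)

  unique-⊆⇒length-≤ : ∀ {xs ys : List A} → Unique xs → xs ⊆ ys → length xs ≤ length ys
  unique-⊆⇒length-≤ uniq xs⊆ys =
    injective⇒≤-length (unique⇒lookup-injective uniq) (λ i → xs⊆ys (∈-lookup i))

module _ {A : Set} (_≟′_ : DecidableEquality A) where

  open DecMembership _≟′_ using () renaming (_∈?_ to _∈ˡ?_)

  -- Needed to fill up at most three removed edges to exactly three. While `xs` is shorter than `ys`
  -- some entry of `ys` is missing from it and can be added; `d` counts the additions still to be
  -- made.
  extend : ∀ {xs ys : List A} k d → Unique xs → Unique ys → xs ⊆ ys →
           length xs + d ≡ k → k ≤ length ys →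
           ∃[ zs ] Unique zs × xs ⊆ zs × zs ⊆ ys × length zs ≡ k
  extend {xs} k zero    xs! ys! xs⊆ys eq _ = xs , xs! , (λ x → x) , xs⊆ys , trans (sym (+-identityʳ _)) eq
  extend {xs} {ys} k (suc d) xs! ys! xs⊆ys eq k≤ with All.all? (_∈ˡ? xs) ys
  ... | yes ys⊆xs = contradiction
    (≤-trans k≤ (unique-⊆⇒length-≤ ys! (All.lookup ys⊆xs)))
    (<⇒≱ (subst (length xs <_) eq (m<m+n (length xs) (s≤s z≤n))))
  ... | no ¬ys⊆xs with find (¬All⇒Any¬ (_∈ˡ? xs) ys ¬ys⊆xs)
  ...   | y , y∈ys , y∉xs with extend {y ∷ xs} k d (¬Any⇒All¬ xs y∉xs ∷ xs!) ys!
                            (λ where (here refl) → y∈ys ; (there x∈xs) → xs⊆ys x∈xs)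
                            (trans (sym (+-suc _ d)) eq) k≤
  ...     | zs , zs! , y∷xs⊆zs , zs⊆ys , len = zs , zs! , y∷xs⊆zs ∘ there , zs⊆ys , len

neighbours : ∀ {n} → Graph n → Fin n → List (Fin n)
neighbours {n} G v = filter (Adj? G v) (allFin n)

degree : ∀ {n} → Graph n → Fin n → ℕ
degree G v = length (neighbours G v)

∈-neighbours : ∀ {n} (G : Graph n) {v x} → Adj G v x → x ∈ˡ neighbours G v
∈-neighbours G v~x = ∈-filter⁺ (Adj? G _) (∈-allFin _) v~x

∈-neighbours⁻ : ∀ {n} (G : Graph n) {v x} → x ∈ˡ neighbours G v → Adj G v x
∈-neighbours⁻ {n} G x∈ = proj₂ (∈-filter⁻ (Adj? G _) {xs = allFin n} x∈)

E-unique : ∀ {n} (G : Graph n) → Unique (E G)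
E-unique {n} G = Unique.filter⁺ (isEdge? G)
  (Unique.cartesianProduct⁺ (Unique.allFin⁺ n) (Unique.allFin⁺ n))

-- `w ≡ v` stands for `u` and `v` being adjacent, `Adj G w v` for a common neighbour. The bound 4 is
-- the three edges that may be deleted plus one incidence at `v` that costs nothing.
LightPair : ∀ {n} → Graph n → (u v w : Fin n) → Set
LightPair G u v w =
  Adj G u w × u ≢ v × (w ≡ v ⊎ Adj G w v) × degree G u + degree G v ≤ 4

lightPair? : ∀ {n} (G : Graph n) → Dec (∃[ u ] ∃[ v ] ∃[ w ] LightPair G u v w)
lightPair? G = Fin.any? λ u → Fin.any? λ v → Fin.any? λ w →
  Adj? G u w ×-dec ¬? (u Fin.≟ v) ×-dec ((w Fin.≟ v) ⊎-dec Adj? G w v) ×-dec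
  (degree G u + degree G v ≤? 4)

edge : ∀ {n} → Fin n → Fin n → Pair n
edge u v with u Fin.<? v
... | yes _ = u , v
... | no  _ = v , u

edge-isEdge : ∀ {n} (G : Graph n) {u v} → Adj G u v → IsEdge G (edge u v)
edge-isEdge G {u} {v} u~v with u Fin.<? v
... | yes u<v = u<v , u~v
... | no  u≮v = Fin.≤∧≢⇒< (≮⇒≥ u≮v) (Adj-irrefl G u~v ∘ sym) , Adj-sym G u~v

edge-∈ : ∀ {n} {u v : Fin n} {es} → edge u v ∈ˡ es → (u , v) ∈ˡ es ⊎ (v , u) ∈ˡ es
edge-∈ {u = u} {v} e∈ with u Fin.<? v
... | yes _ = inj₁ e∈
... | no  _ = inj₂ e∈

─-adj-edge : ∀ {n} (G : Graph n) {es u v} → edge u v ∈ˡ es → ¬ Adj (G ─ es) u v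
─-adj-edge G {es} e∈ u~v with ─-adj⁻ G es u~v
... | _ , ∉₁ , ∉₂ = [ ∉₁ , ∉₂ ]′ (edge-∈ e∈)

module _ {n} (G : Graph n) {u v w : Fin n} (light-pair : LightPair G u v w) where

  private
    u~w     = proj₁ light-pair
    u≢v     = proj₁ (proj₂ light-pair)
    w≡v⊎w~v = proj₁ (proj₂ (proj₂ light-pair))
    light   = proj₂ (proj₂ (proj₂ light-pair))

    -- The edge at v that need not be removed: if w = v, then it is uv, which
    -- is removed as an edge at u.
    spared : ∃[ x ] Adj G v x × ((w ≡ v × x ≡ u) ⊎ x ≡ w)
    spared with w≡v⊎w~v
    ... | inj₁ refl = u , Adj-sym G u~w , inj₁ (refl , refl)
    ... | inj₂ w~v  = w , Adj-sym G w~v , inj₂ refl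

    x₀ : Fin n
    x₀ = proj₁ spared

    ≢x₀? : ∀ x → Dec (x ≢ x₀)
    ≢x₀? x = ¬? (x Fin.≟ x₀)

    removed : List (Pair n)
    removed = map (edge u) (neighbours G u) ++ map (edge v) (filter ≢x₀? (neighbours G v))

    ∣removed∣≤3 : length removed ≤ 3
    ∣removed∣≤3 = s≤s⁻¹ (begin
      suc (length removed)
        ≡⟨ cong suc (trans (length-++ (map (edge u) (neighbours G u)))
             (cong₂ _+_ (length-map (edge u) (neighbours G u)) (length-map (edge v) (filter ≢x₀? (neighbours G v))))) ⟩
      suc (degree G u + length (filter ≢x₀? (neighbours G v)))
        ≡⟨ +-suc (degree G u) _ ⟨
      degree G u + suc (length (filter ≢x₀? (neighbours G v)))
        -- The neighbour `x₀` of `v` fails the filter, which saves one of the four edges.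
        ≤⟨ +-monoʳ-≤ (degree G u) (filter-notAll ≢x₀? _
             (lose (∈-neighbours G (proj₁ (proj₂ spared))) λ ≢ → ≢ refl)) ⟩
      degree G u + degree G v
        ≤⟨ light ⟩
      4 ∎)
      where open ≤-Reasoning

    removed-u : ∀ {x} → Adj G u x → edge u x ∈ˡ removed
    removed-u u~x = ∈-++⁺ˡ (∈-map⁺ (edge u) (∈-neighbours G u~x))

    removed-v : ∀ {x} → Adj G v x → x ≢ x₀ → edge v x ∈ˡ removed
    removed-v v~x x≢x₀ = ∈-++⁺ʳ _ (∈-map⁺ (edge v) (∈-filter⁺ ≢x₀? (∈-neighbours G v~x) x≢x₀))

    removed⊆E : removed ⊆ E G
    removed⊆E e∈ with ∈-++⁻ (map (edge u) (neighbours G u)) e∈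
    ... | inj₁ e∈ with ∈-map⁻ (edge u) e∈
    ...   | x , x∈ , refl = ∈E⁺ G (edge-isEdge G (∈-neighbours⁻ G x∈))
    removed⊆E _ | inj₂ e∈ with ∈-map⁻ (edge v) e∈
    ...   | x , x∈ , refl =
      ∈E⁺ G (edge-isEdge G (∈-neighbours⁻ G (proj₁ (∈-filter⁻ ≢x₀? {xs = neighbours G v} x∈))))

    removed⇒separates : ∀ {E′} → removed ⊆ E′ → Separates G E′ u v w
    removed⇒separates {E′} removed⊆E′ = record
      { u~w        = u~w
      ; u≢v        = u≢v
      ; w≡v⊎w~v    = w≡v⊎w~v
      ; u-isolated = u-isolated
      ; v-pendant  = v-pendant
      }
      where
      u-isolated : ∀ x → ¬ Adj (G ─ E′) u x
      u-isolated x u~x =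
        ─-adj-edge G (removed⊆E′ (removed-u (proj₁ (─-adj⁻ G E′ u~x)))) u~x

      v-pendant : ∀ x → Adj (G ─ E′) v x → x ≡ w
      v-pendant x v~x with x Fin.≟ x₀ | proj₂ (proj₂ spared)
      ... | no x≢x₀  | _ =
        contradiction v~x (─-adj-edge G (removed⊆E′ (removed-v (proj₁ (─-adj⁻ G E′ v~x)) x≢x₀)))
      ... | yes x≡x₀ | inj₂ x₀≡w = trans x≡x₀ x₀≡w
      ... | yes x≡x₀ | inj₁ (_ , x₀≡u) =
        contradiction (subst (λ y → Adj (G ─ E′) y v) (trans x≡x₀ x₀≡u) (Adj-sym (G ─ E′) v~x)) (u-isolated v)

  light⇒separates : 3 ≤ length (E G) → ∃[ e₁ ] ∃[ e₂ ] ∃[ e₃ ]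
    let E′ = e₁ ∷ e₂ ∷ e₃ ∷ [] in Unique E′ × E′ ⊆ E G × Separates G E′ u v w
  light⇒separates 3≤ with extend _≟ᵖ_ 3 (3 ∸ length D) D-unique (E-unique G) (removed⊆E ∘ D⊆removed)
    (m+[n∸m]≡n (≤-trans (unique-⊆⇒length-≤ D-unique D⊆removed) ∣removed∣≤3)) 3≤
    where
    -- If `w` is a common neighbour and `u` and `v` are adjacent as well, the edge between them
    -- occurs twice in `removed`.
    D : List (Pair n)
    D = deduplicate _≟ᵖ_ removed

    D-unique : Unique D
    D-unique = DecUnique.deduplicate-! _≟ᵖ_ removed

    D⊆removed : D ⊆ removed
    D⊆removed = ∈-deduplicate⁻ _≟ᵖ_ removed
  ... | e₁ ∷ e₂ ∷ e₃ ∷ [] , unique , D⊆E′ , E′⊆E , refl =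
    e₁ , e₂ , e₃ , unique , E′⊆E , removed⇒separates (D⊆E′ ∘ ∈-deduplicate⁺ _≟ᵖ_)

nonempty⇒adjacent : ∀ {n} (G : Graph n) → 0 < length (E G) → ∃[ a ] ∃[ b ] Adj G a b
nonempty⇒adjacent G 0<∣E∣ =
  _ , _ , proj₂ (∈E⁻ G (∈-lookup {xs = E G} (Fin.fromℕ< 0<∣E∣)))

difference : ∀ {m n} → m ≤ n → ∃[ o ] o + m ≡ n
difference m≤n = _ , m∸n+n≡m m≤n

-- Short closed walks

-- The closed walk w 0, …, w (suc m), w 0, which may backtrack only at w 0.
record ClosedWalk {n} (G : Graph n) (m : ℕ) (w : ℕ → Fin n) : Set where
  field
    steps           : ∀ {i} → i < suc m → Adj G (w i) (w (suc i))
    nonbacktracking : ∀ {i} → i < m → w i ≢ w (2 + i)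
    closing         : Adj G (w (suc m)) (w 0)
    nonbacktracking-end : w m ≢ w 0

module _ {n : ℕ} (G : Graph n) where

  HasShortInducedCycle : ℕ → Set
  HasShortInducedCycle m = ∃[ k ] k ≤ 2 + m × ∃ (IsInducedCycle G k)

  -- A repeated vertex or a chord cuts off a strictly shorter closed walk, and a walk with neither
  -- is itself an induced cycle. Permitting a backtrack at the base point keeps the induction going:
  -- a segment between two visits of a vertex may well leave and return along the same edge.
  closed-walk⇒cycle : ∀ m (w : ℕ → Fin n) → ClosedWalk G m w → HasShortInducedCycle m
  closed-walk⇒cycle = <-rec (λ m → ∀ w → ClosedWalk G m w → HasShortInducedCycle m) shorten
    where
    shorten : ∀ m → (∀ {m′} → m′ < m → ∀ w → ClosedWalk G m′ w → HasShortInducedCycle m′) →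
              ∀ w → ClosedWalk G m w → HasShortInducedCycle m
    shorten m rec w walk
      with Fin.any? (λ (i : Fin (2 + m)) → Fin.any? λ (j : Fin (2 + m)) → (i Fin.<? j) ×-dec (w (toℕ i) Fin.≟ w (toℕ j)))
         | Fin.any? (λ (i : Fin (2 + m)) → Fin.any? λ (j : Fin (2 + m)) →
             (2 + toℕ i ≤? toℕ j) ×-dec (¬? ((toℕ i ≟ 0) ×-dec (toℕ j ≟ suc m)) ×-dec Adj? G (w (toℕ i)) (w (toℕ j))))
    ... | yes (i , j , i<j , wi≡wj) | _ = repeated (toℕ i) (toℕ j) i<j (s≤s⁻¹ (Fin.toℕ<n j)) wi≡wj
      where
      open ClosedWalk walk

      repeated : ∀ i j → i < j → j ≤ suc m → w i ≡ w j → HasShortInducedCycle m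
      repeated i j i<j j≤ wi≡wj with difference i<j
      ... | 0 , refl = contradiction wi≡wj (Adj-irrefl G (steps j≤))
      ... | 1 , refl = contradiction wi≡wj (nonbacktracking (s≤s⁻¹ j≤))
      ... | suc (suc e) , refl = cycle
        where
        j′≤ : 3 + (e + i) ≤ suc m
        j′≤ = subst (_≤ suc m) (cong (2 +_) (+-suc e i)) j≤

        wi≡ : w i ≡ w (3 + (e + i))
        wi≡ = trans wi≡wj (cong (λ x → w (2 + x)) (+-suc e i))

        1+e<m : suc e < m
        1+e<m = s≤s⁻¹ (≤-trans (s≤s (s≤s (s≤s (m≤m+n e i)))) j′≤)

        cycle : HasShortInducedCycle m
        cycle with rec 1+e<m (λ x → w (x + i)) record
          { steps           = λ x< → steps (≤-trans (+-monoˡ-< i x<) (≤-trans (n≤1+n _) j′≤))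
          ; nonbacktracking = λ x< → nonbacktracking (≤-trans (+-monoˡ-< i x<) (≤-trans (n≤1+n _) (s≤s⁻¹ j′≤)))
          ; closing         = subst (Adj G (w (2 + (e + i)))) (sym wi≡) (steps j′≤)
          ; nonbacktracking-end = subst (w (1 + (e + i)) ≢_) (sym wi≡) (nonbacktracking (s≤s⁻¹ j′≤))
          }
        ... | k , k≤ , c = k , ≤-trans k≤ (s≤s (s≤s (<⇒≤ 1+e<m))) , c
    ... | no distinct | yes (i , j , 2+i≤j , ¬ends , chord) =
      shortcut (toℕ i) (toℕ j) 2+i≤j (s≤s⁻¹ (Fin.toℕ<n j)) ¬ends chord
      where
      open ClosedWalk walk

      shortcut : ∀ i j → 2 + i ≤ j → j ≤ suc m → ¬ (i ≡ 0 × j ≡ suc m) → Adj G (w i) (w j) →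
                 HasShortInducedCycle m
      shortcut i j 2+i≤j j≤ ¬ends chord with difference 2+i≤j
      ... | e , refl = cycle
        where
        j≡ : e + (2 + i) ≡ 2 + (e + i)
        j≡ = trans (+-suc e (suc i)) (cong suc (+-suc e i))

        j′≤ : 2 + (e + i) ≤ suc m
        j′≤ = subst (_≤ suc m) j≡ j≤

        -- Only the closing edge, from position 0 to the last one, would give back a walk of the
        -- same length, and it does not count as a chord.
        1+e≢m : suc e ≢ m
        1+e≢m refl = ¬ends (i≡0 , trans j≡ (cong (2 +_) (trans (cong (e +_) i≡0) (+-identityʳ e))))
          where
          i≡0 : i ≡ 0
          i≡0 = n≤0⇒n≡0 (+-cancelˡ-≤ e i 0 (≤-trans (s≤s⁻¹ (s≤s⁻¹ j′≤)) (≤-reflexive (sym (+-identityʳ e)))))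

        1+e<m : suc e < m
        1+e<m = ≤∧≢⇒< (s≤s⁻¹ (≤-trans (s≤s (s≤s (m≤m+n e i))) j′≤)) 1+e≢m

        apart : ∀ {x y} → x < y → y < 2 + m → w x ≢ w y
        apart x<y y< eq = distinct
          ( fromℕ< (<-trans x<y y<) , fromℕ< y<
          , subst₂ _<_ (sym (Fin.toℕ-fromℕ< _)) (sym (Fin.toℕ-fromℕ< y<)) x<y
          , trans (cong w (Fin.toℕ-fromℕ< _)) (trans eq (cong w (sym (Fin.toℕ-fromℕ< y<)))))

        cycle : HasShortInducedCycle m
        cycle with rec 1+e<m (λ x → w (x + i)) record
          { steps           = λ x< → steps (≤-trans (+-monoˡ-< i x<) j′≤)
          ; nonbacktracking = λ x< → nonbacktracking (≤-trans (+-monoˡ-< i x<) (s≤s⁻¹ j′≤))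
          ; closing         = Adj-sym G (subst (Adj G (w i)) (cong w j≡) chord)
          ; nonbacktracking-end = apart (s≤s (m≤n+m i e)) (≤-trans j′≤ (n≤1+n _)) ∘ sym
          }
        ... | k , k≤ , c = k , ≤-trans k≤ (s≤s (s≤s (<⇒≤ 1+e<m))) , c
    ... | no distinct | no chordless =
      2 + m , ≤-refl , w ∘ toℕ , (s≤s (s≤s (n≢0⇒n>0 m≢0)) , injective , consecutive) , induced
      where
      open ClosedWalk walk

      m≢0 : m ≢ 0
      m≢0 refl = nonbacktracking-end refl

      injective : Injective _≡_ _≡_ (w ∘ toℕ)
      injective {i} {j} eq with Fin.<-cmp i j
      ... | tri< i<j _ _ = contradiction (i , j , i<j , eq) distinct
      ... | tri≈ _ i≡j _ = i≡j
      ... | tri> _ _ j<i = contradiction (j , i , j<i , sym eq) distinct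

      consecutive : ∀ (i j : Fin (2 + m)) → CyclicSuccessor i j → Adj G (w (toℕ i)) (w (toℕ j))
      consecutive i j (inj₁ 1+i≡j) = subst (Adj G (w (toℕ i)) ∘ w) 1+i≡j
        (steps (s≤s⁻¹ (subst (_< 2 + m) (sym 1+i≡j) (Fin.toℕ<n j))))
      consecutive i j (inj₂ (1+i≡2+m , j≡0)) = subst₂ (λ x y → Adj G (w x) (w y))
        (sym (suc-injective 1+i≡2+m)) (sym j≡0) closing

      induced-< : ∀ (i j : Fin (2 + m)) → toℕ i < toℕ j → Adj G (w (toℕ i)) (w (toℕ j)) →
                  CyclicSuccessor i j ⊎ CyclicSuccessor j i
      induced-< i j i<j i~j with suc (toℕ i) ≟ toℕ j | toℕ i ≟ 0 | toℕ j ≟ suc m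
      ... | yes 1+i≡j | _       | _         = inj₁ (inj₁ 1+i≡j)
      ... | no _      | yes i≡0 | yes j≡1+m = inj₂ (inj₂ (cong suc j≡1+m , i≡0))
      ... | no 1+i≢j  | yes i≡0 | no j≢     =
        contradiction (i , j , ≤∧≢⇒< i<j 1+i≢j , (λ (_ , j≡) → j≢ j≡) , i~j) chordless
      ... | no 1+i≢j  | no i≢0  | _         =
        contradiction (i , j , ≤∧≢⇒< i<j 1+i≢j , (λ (i≡0 , _) → i≢0 i≡0) , i~j) chordless

      induced : ∀ (i j : Fin (2 + m)) → Adj G (w (toℕ i)) (w (toℕ j)) →
                CyclicSuccessor i j ⊎ CyclicSuccessor j i
      induced i j i~j with <-cmp (toℕ i) (toℕ j)
      ... | tri< i<j _ _ = induced-< i j i<j i~j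
      ... | tri≈ _ i≡j _ = contradiction (cong w i≡j) (Adj-irrefl G i~j)
      ... | tri> _ _ j<i with induced-< j i j<i (Adj-sym G i~j)
      ...   | inj₁ s = inj₂ s
      ...   | inj₂ s = inj₁ s

  girth⇒¬cycle : ∀ {g k c} → GirthAtLeast g G → k < g → ¬ IsInducedCycle G k c
  girth⇒¬cycle {k = k} {c} ([ h ] , (_ , least) , [ g≤h ]) k<g cycle =
    <⇒≱ k<g (≤-trans g≤h (least k (c , cycle)))
  girth⇒¬cycle {k = k} {c} (⊤⁺ , acyclic , _) k<g (cycle , _) = acyclic k c cycle

  -- A return after one step is a loop and after two steps a backtrack. A later one closes the walk,
  -- and nothing is known about its turn at `w 0`, which is the turn that `ClosedWalk` leaves free.
  -- The resulting cycle has at most `suc k` vertices.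
  girth⇒¬return : ∀ {g} → GirthAtLeast g G → (w : ℕ → Fin n) → (∀ i → Adj G (w i) (w (suc i))) →
                  (∀ i → w i ≢ w (2 + i)) → ∀ k → suc k < g → w (suc k) ≢ w 0
  girth⇒¬return girth w steps nb 0 k<g wk≡ = Adj-irrefl G (steps 0) (sym wk≡)
  girth⇒¬return girth w steps nb 1 k<g wk≡ = nb 0 (sym wk≡)
  girth⇒¬return girth w steps nb (suc (suc e)) k<g wk≡
    with closed-walk⇒cycle (suc e) w record
      { steps = λ {i} _ → steps i ; nonbacktracking = λ {i} _ → nb i
      ; closing = subst (Adj G (w (2 + e))) wk≡ (steps (2 + e))
      ; nonbacktracking-end = subst (w (1 + e) ≢_) wk≡ (nb (1 + e)) }
  ... | k , k≤ , c , cycle = girth⇒¬cycle girth (≤-<-trans k≤ k<g) cycle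

-- Sums and indicator functions

⟦_⟧ : Bool → ℕ
⟦ b ⟧ = if b then 1 else 0

sum-mono : ∀ {n} {f g : Fin n → ℕ} → (∀ i → f i ≤ g i) → sum f ≤ sum g
sum-mono {zero}  f≤g = z≤n
sum-mono {suc n} f≤g = +-mono-≤ (f≤g zero) (sum-mono (f≤g ∘ suc))

sum-const : ∀ n k → sum {n} (λ _ → k) ≡ n * k
sum-const zero    k = refl
sum-const (suc n) k = cong (k +_) (sum-const n k)

sum-zero : ∀ {n} {f : Fin n → ℕ} → (∀ i → f i ≡ 0) → sum f ≡ 0
sum-zero {n} f≡0 = trans (sum-cong-≗ f≡0) (trans (sum-const n 0) (*-zeroʳ n))

sum-≤-single : ∀ {n b} {f : Fin n → ℕ} → (∀ i j → f i ≢ 0 → f j ≢ 0 → i ≡ j) →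
               (∀ i → f i ≤ b) → sum f ≤ b
sum-≤-single {zero}  single f≤b = z≤n
sum-≤-single {suc n} {f = f} single f≤b with f zero ≟ 0
... | yes f0≡0 rewrite f0≡0 =
  sum-≤-single (λ i j fi fj → Fin.suc-injective (single (suc i) (suc j) fi fj)) (f≤b ∘ suc)
... | no  f0≢0 = ≤-trans (≤-reflexive (trans (cong (f zero +_) (sum-zero rest≡0)) (+-identityʳ _))) (f≤b zero)
  where
  rest≡0 : ∀ i → f (suc i) ≡ 0
  rest≡0 i = decidable-stable (f (suc i) ≟ 0) λ fi≢0 →
    contradiction (single zero (suc i) f0≢0 fi≢0) λ ()

module _ {A : Set} {P : A → Set} (P? : Decidable P) where

  length-filter-tabulate : ∀ {n} (f : Fin n → A) →
                           length (filter P? (tabulate f)) ≡ sum (λ i → ⟦ does (P? (f i)) ⟧)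
  length-filter-tabulate {zero}  f = refl
  length-filter-tabulate {suc n} f with does (P? (f zero))
  ... | true  = cong suc (length-filter-tabulate (f ∘ suc))
  ... | false = length-filter-tabulate (f ∘ suc)

length-filter-cartesianProduct :
  ∀ {A B : Set} {P : A × B → Set} (P? : Decidable P) {m n} (f : Fin m → A) (g : Fin n → B) →
  length (filter P? (cartesianProduct (tabulate f) (tabulate g))) ≡
  sum (λ i → sum λ j → ⟦ does (P? (f i , g j)) ⟧)
length-filter-cartesianProduct P? {zero}  f g = refl
length-filter-cartesianProduct P? {suc m} f g = begin
  length (filter P? (map (f zero ,_) (tabulate g) ++ rest))
    ≡⟨ cong length (filter-++ P? (map (f zero ,_) (tabulate g)) rest) ⟩
  length (filter P? (map (f zero ,_) (tabulate g)) ++ filter P? rest)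
    ≡⟨ length-++ (filter P? (map (f zero ,_) (tabulate g))) ⟩
  length (filter P? (map (f zero ,_) (tabulate g))) + length (filter P? rest)
    ≡⟨ cong₂ _+_ (trans (cong (length ∘ filter P?) (map-tabulate g (f zero ,_)))
                        (length-filter-tabulate P? (λ j → f zero , g j)))
                 (length-filter-cartesianProduct P? (f ∘ suc) g) ⟩
  sum (λ i → sum λ j → ⟦ does (P? (f i , g j)) ⟧) ∎
  where
  open ≡-Reasoning
  rest = cartesianProduct (tabulate (f ∘ suc)) (tabulate g)

⟦⟧*-≤ : ∀ b {x k} → (T b → x ≤ k) → ⟦ b ⟧ * x ≤ k
⟦⟧*-≤ true  {x} x≤k = ≤-trans (≤-reflexive (+-identityʳ x)) (x≤k tt)
⟦⟧*-≤ false     x≤k = z≤n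

⟦⟧*-≢0 : ∀ b {x} → ⟦ b ⟧ * x ≢ 0 → T b × x ≢ 0
⟦⟧*-≢0 true  {x} ≢0 = tt , λ x≡0 → ≢0 (trans (+-identityʳ x) x≡0)
⟦⟧*-≢0 false     ≢0 = contradiction refl ≢0

-- Degree counting and discharging

module _ {n : ℕ} (G : Graph n) where

  degree≡sum : ∀ v → degree G v ≡ sum (λ u → ⟦ adj G v u ⟧)
  degree≡sum v = length-filter-tabulate (Adj? G v) (λ u → u)

  adj-symmetric-sum : ∀ (f : Fin n → ℕ) →
                      sum (λ v → sum λ u → ⟦ adj G v u ⟧ * f u) ≡ sum (λ u → degree G u * f u)
  adj-symmetric-sum f = trans (∑-comm (λ v u → ⟦ adj G v u ⟧ * f u)) (sum-cong-≗ λ u → begin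
    sum (λ v → ⟦ adj G v u ⟧ * f u)    ≡⟨ *-distribʳ-sum (f u) (λ v → ⟦ adj G v u ⟧) ⟨
    sum (λ v → ⟦ adj G v u ⟧) * f u
      ≡⟨ cong (_* f u) (trans (sum-cong-≗ λ v → cong ⟦_⟧ (symmetric G v u)) (sym (degree≡sum u))) ⟩
    degree G u * f u ∎)
    where open ≡-Reasoning

  handshake : sum (degree G) ≡ 2 * length (E G)
  handshake = begin
    sum (degree G)
      ≡⟨ sum-cong-≗ degree≡sum ⟩
    sum (λ u → sum λ v → ⟦ adj G u v ⟧)
      ≡⟨ sum-cong-≗ (λ u → sum-cong-≗ λ v → split u v) ⟩
    sum (λ u → sum λ v → up u v + up v u)
      ≡⟨ sum-cong-≗ (λ u → ∑-distrib-+ (up u) (λ v → up v u)) ⟩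
    sum (λ u → sum (up u) + sum λ v → up v u)
      ≡⟨ ∑-distrib-+ (λ u → sum (up u)) (λ u → sum λ v → up v u) ⟩
    sum (λ u → sum (up u)) + sum (λ u → sum λ v → up v u)
      ≡⟨ cong₂ _+_ E≡ (trans (∑-comm (λ u v → up v u)) (trans E≡ (sym (+-identityʳ _)))) ⟩
    2 * length (E G) ∎
    where
    open ≡-Reasoning

    up : Fin n → Fin n → ℕ
    up u v = ⟦ does (isEdge? G (u , v)) ⟧

    E≡ : sum (λ u → sum (up u)) ≡ length (E G)
    E≡ = sym (length-filter-cartesianProduct (isEdge? G) (λ u → u) (λ v → v))

    split : ∀ u v → ⟦ adj G u v ⟧ ≡ up u v + up v u
    split u v with Fin.<-cmp u v
    ... | tri< u<v _ v≮u
      rewrite dec-true (u Fin.<? v) u<v | dec-false (v Fin.<? u) v≮u = sym (+-identityʳ _)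
    ... | tri> u≮v _ v<u
      rewrite dec-false (u Fin.<? v) u≮v | dec-true (v Fin.<? u) v<u = cong ⟦_⟧ (symmetric G u v)
    ... | tri≈ u≮u refl _
      rewrite dec-false (u Fin.<? u) u≮u = cong ⟦_⟧ (loopless G u)

  degree≡0⇒isolated : ∀ {v} → degree G v ≡ 0 → Isolated G v
  degree≡0⇒isolated {v} deg≡0 x v~x with neighbours G v | ∈-neighbours G v~x | deg≡0
  ... | _ ∷ _ | _ | ()

  -- Ordered pairs are used so that `#core` counts darts, namely those that remain when the leaves
  -- are cut off.
  Core : Pair n → Set
  Core (u , v) = Adj G u v × degree G u ≢ 1 × degree G v ≢ 1

  core? : Decidable Core
  core? (u , v) = Adj? G u v ×-dec (¬? (degree G u ≟ 1) ×-dec ¬? (degree G v ≟ 1))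

  #leaves #isolated #core : ℕ
  #leaves   = sum (λ v → ⟦ does (degree G v ≟ 1) ⟧)
  #isolated = length (filter (isolated? G) (allFin n))
  #core     = length (filter core? (cartesianProduct (allFin n) (allFin n)))

  NoLightPair : Set
  NoLightPair = ∀ u v w → ¬ LightPair G u v w

  module _ (no-light : NoLightPair) where

    adjacent⇒heavy : ∀ {u v} → Adj G u v → 5 ≤ degree G u + degree G v
    adjacent⇒heavy {u} {v} u~v =
      ≰⇒> λ light → no-light u v v (u~v , Adj-irrefl G u~v , inj₁ refl , light)

    two-apart⇒heavy : ∀ {u w v} → Adj G w u → Adj G w v → u ≢ v → 5 ≤ degree G u + degree G v
    two-apart⇒heavy {u} {w} {v} w~u w~v u≢v =
      ≰⇒> λ light → no-light u v w (Adj-sym G w~u , u≢v , inj₂ w~v , light)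

    -- Each leaf has one outgoing and one incoming dart. No dart joins two leaves, as these would
    -- form a light pair, so core darts, darts out of leaves and darts into leaves are three
    -- disjoint families among the 2M darts.
    #core+2#leaves≤2#E : #core + 2 * #leaves ≤ 2 * length (E G)
    #core+2#leaves≤2#E = begin
      #core + 2 * #leaves
        ≡⟨ cong₂ _+_ (length-filter-cartesianProduct core? (λ u → u) (λ v → v))
                     (cong₂ _+_ (sym leaves-out) (trans (+-identityʳ #leaves) (sym leaves-in))) ⟩
      sum (λ u → sum (core u)) + (sum (λ u → sum (out u)) + sum (λ u → sum (in′ u)))
        ≡⟨ cong (sum (λ u → sum (core u)) +_) (∑-distrib-+ (λ u → sum (out u)) (λ u → sum (in′ u))) ⟨
      sum (λ u → sum (core u)) + sum (λ u → sum (out u) + sum (in′ u))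
        ≡⟨ ∑-distrib-+ (λ u → sum (core u)) (λ u → sum (out u) + sum (in′ u)) ⟨
      sum (λ u → sum (core u) + (sum (out u) + sum (in′ u)))
        ≤⟨ sum-mono (λ u → ≤-trans (≤-reflexive (sym (merge u))) (sum-mono (pointwise u))) ⟩
      sum (λ u → sum λ v → ⟦ adj G u v ⟧)
        ≡⟨ sum-cong-≗ degree≡sum ⟨
      sum (degree G)
        ≡⟨ handshake ⟩
      2 * length (E G) ∎
      where
      open ≤-Reasoning

      leaf : Fin n → ℕ
      leaf v = ⟦ does (degree G v ≟ 1) ⟧

      core out in′ : Fin n → Fin n → ℕ
      core u v = ⟦ does (core? (u , v)) ⟧
      out u v = ⟦ adj G u v ⟧ * leaf u
      in′ u v = ⟦ adj G u v ⟧ * leaf v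

      degree*leaf : ∀ v → degree G v * leaf v ≡ leaf v
      degree*leaf v = by-degree (degree G v)
        where
        by-degree : ∀ d → d * ⟦ does (d ≟ 1) ⟧ ≡ ⟦ does (d ≟ 1) ⟧
        by-degree 0             = refl
        by-degree 1             = refl
        by-degree (suc (suc d)) = *-zeroʳ d

      leaves-in : sum (λ u → sum (in′ u)) ≡ #leaves
      leaves-in = trans (adj-symmetric-sum leaf) (sum-cong-≗ degree*leaf)

      leaves-out : sum (λ u → sum (out u)) ≡ #leaves
      leaves-out = sum-cong-≗ λ u →
        trans (sym (*-distribʳ-sum (leaf u) (λ v → ⟦ adj G u v ⟧)))
              (trans (cong (_* leaf u) (sym (degree≡sum u))) (degree*leaf u))

      merge : ∀ u → sum (λ v → core u v + (out u v + in′ u v)) ≡ sum (core u) + (sum (out u) + sum (in′ u))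
      merge u = trans (∑-distrib-+ (core u) (λ v → out u v + in′ u v))
                      (cong (sum (core u) +_) (∑-distrib-+ (out u) (in′ u)))

      pointwise : ∀ u v → core u v + (out u v + in′ u v) ≤ ⟦ adj G u v ⟧
      pointwise u v = by-degrees (adj G u v) (degree G u) (degree G v) (adjacent⇒heavy {u} {v})
        where
        by-degrees : ∀ b d e → (T b → 5 ≤ d + e) →
          ⟦ b ∧ (not (does (d ≟ 1)) ∧ not (does (e ≟ 1))) ⟧ + (⟦ b ⟧ * ⟦ does (d ≟ 1) ⟧ + ⟦ b ⟧ * ⟦ does (e ≟ 1) ⟧) ≤ ⟦ b ⟧
        by-degrees false d e heavy = z≤n
        by-degrees true  d e heavy with d ≡ᵇ 1 in d≡ | e ≡ᵇ 1 in e≡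
        ... | false | false = ≤-refl
        ... | false | true  = ≤-refl
        ... | true  | false = ≤-refl
        ... | true  | true  = contradiction
          (subst (5 ≤_) (cong₂ _+_ (≡ᵇ⇒≡ d 1 (subst T (sym d≡) tt)) (≡ᵇ⇒≡ e 1 (subst T (sym e≡) tt))) (heavy tt))
          λ where (s≤s (s≤s ()))

    -- In the discharging argument a vertex of degree d starts with 3 d and ends
    -- with at least need d, after every vertex of degree 1 or 2 has received
    -- its supply from each neighbour.
    need supply : ℕ → ℕ
    need 0 = 0
    need 1 = 6
    need _ = 8
    supply 1 = 3
    supply 2 = 1
    supply _ = 0

    supply-≥3 : ∀ {d} → 3 ≤ d → supply d ≡ 0
    supply-≥3 (s≤s (s≤s (s≤s _))) = refl

    supply-≥2 : ∀ {d} → 2 ≤ d → supply d ≤ 1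
    supply-≥2 {2}                 _ = ≤-refl
    supply-≥2 {suc (suc (suc _))} _ = z≤n
    supply-≥2 {1} (s≤s ())

    supply-≤3 : ∀ d → supply d ≤ 3
    supply-≤3 0                   = z≤n
    supply-≤3 1                   = ≤-refl
    supply-≤3 2                   = s≤s z≤n
    supply-≤3 (suc (suc (suc _))) = z≤n

    supply-≢0 : ∀ {d} → supply d ≢ 0 → d ≤ 2
    supply-≢0 ≢0 = ≮⇒≥ (≢0 ∘ supply-≥3)

    supplied : Fin n → ℕ
    supplied v = sum (λ u → ⟦ adj G v u ⟧ * supply (degree G u))

    supplied-≡0 : ∀ v → degree G v ≤ 2 → supplied v ≡ 0
    supplied-≡0 v d≤2 = sum-zero λ u → n≤0⇒n≡0 (⟦⟧*-≤ (adj G v u) λ v~u → ≤-reflexive (supply-≥3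
      (+-cancelˡ-≤ 2 3 _ (≤-trans (adjacent⇒heavy v~u) (+-monoˡ-≤ _ d≤2)))))

    -- Two distinct neighbours of `v` that both have degree at most 2 would form a light pair, so
    -- `v` supplies at most one vertex.
    supplied-≤ : ∀ v {b} → (∀ u → Adj G v u → supply (degree G u) ≤ b) → supplied v ≤ b
    supplied-≤ v s≤b = sum-≤-single
      (λ u u′ ≢0 ≢0′ → decidable-stable (u Fin.≟ u′) λ u≢u′ →
        let v~u  , su≢0  = ⟦⟧*-≢0 (adj G v u) ≢0
            v~u′ , su′≢0 = ⟦⟧*-≢0 (adj G v u′) ≢0′
        in <⇒≱ (two-apart⇒heavy v~u v~u′ u≢u′) (+-mono-≤ (supply-≢0 su≢0) (supply-≢0 su′≢0)))
      (λ u → ⟦⟧*-≤ (adj G v u) (s≤b u))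

    -- A leaf ends with 3 + 3 = 6 and a vertex of degree 2 with 6 + 2 = 8, as neither has a
    -- neighbour to supply. Degree 3 leaves 9 - 1, because a neighbour of such a vertex is not a
    -- leaf. From degree 4 on there is at least 12, of which at most 3 is given away.
    discharge : ∀ v → need (degree G v) + supplied v ≤ 3 * degree G v + degree G v * supply (degree G v)
    discharge v = by-degree (degree G v) refl
      where
      by-degree : ∀ d → degree G v ≡ d → need d + supplied v ≤ 3 * d + d * supply d
      by-degree 0 d≡ = ≤-reflexive (supplied-≡0 v (≤-trans (≤-reflexive d≡) z≤n))
      by-degree 1 d≡ = ≤-reflexive (cong (6 +_) (supplied-≡0 v (≤-trans (≤-reflexive d≡) (s≤s z≤n))))
      by-degree 2 d≡ = ≤-reflexive (cong (8 +_) (supplied-≡0 v (≤-reflexive d≡)))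
      by-degree 3 d≡ = +-monoʳ-≤ 8 (supplied-≤ v λ u v~u → supply-≥2
        (+-cancelˡ-≤ 3 2 _ (subst (λ d → 5 ≤ d + degree G u) d≡ (adjacent⇒heavy v~u))))
      by-degree (suc (suc (suc (suc d)))) d≡ = begin
        8 + supplied v                       ≤⟨ +-monoʳ-≤ 8 (supplied-≤ v λ u _ → supply-≤3 (degree G u)) ⟩
        11                                   ≤⟨ m≤m+n 11 (1 + 3 * d) ⟩
        11 + (1 + 3 * d)                     ≡⟨ *-distribˡ-+ 3 4 d ⟨
        3 * (4 + d)                          ≤⟨ m≤m+n _ _ ⟩
        3 * (4 + d) + (4 + d) * 0            ∎
        where open ≤-Reasoning

    -- Supply only moves between adjacent vertices: the amounts given and received have the same
    -- total by `adj-symmetric-sum` and cancel.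
    sum-need-≤ : sum (need ∘ degree G) ≤ 6 * length (E G)
    sum-need-≤ = +-cancelʳ-≤ (sum supplied) _ _ (begin
      sum (need ∘ degree G) + sum supplied
        ≡⟨ ∑-distrib-+ (need ∘ degree G) supplied ⟨
      sum (λ v → need (degree G v) + supplied v)
        ≤⟨ sum-mono discharge ⟩
      sum (λ v → 3 * degree G v + degree G v * supply (degree G v))
        ≡⟨ ∑-distrib-+ (λ v → 3 * degree G v) (λ v → degree G v * supply (degree G v)) ⟩
      sum (λ v → 3 * degree G v) + sum (λ v → degree G v * supply (degree G v))
        ≡⟨ cong₂ _+_ (sym (*-distribˡ-sum 3 (degree G))) (sym (adj-symmetric-sum (supply ∘ degree G))) ⟩
      3 * sum (degree G) + sum supplied
        ≡⟨ cong (λ x → 3 * x + sum supplied) handshake ⟩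
      3 * (2 * length (E G)) + sum supplied
        ≡⟨ cong (_+ sum supplied) (*-assoc 3 2 (length (E G))) ⟨
      6 * length (E G) + sum supplied ∎)
      where open ≤-Reasoning

    -- `need` falls short of 8 by 8 at an isolated vertex and by 2 at a leaf, and the added terms
    -- make up for this.
    8n≤ : 8 * n ≤ 6 * length (E G) + (8 * #isolated + 2 * #leaves)
    8n≤ = begin
      8 * n                                               ≡⟨ trans (*-comm 8 n) (sym (sum-const n 8)) ⟩
      sum {n} (λ _ → 8)                                   ≤⟨ sum-mono pointwise ⟩
      sum (λ v → need (degree G v) + (8 * iso v + 2 * leaf v))
        ≡⟨ trans (∑-distrib-+ (need ∘ degree G) (λ v → 8 * iso v + 2 * leaf v))
                 (cong (sum (need ∘ degree G) +_) (∑-distrib-+ (λ v → 8 * iso v) (λ v → 2 * leaf v))) ⟩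
      sum (need ∘ degree G) + (sum (λ v → 8 * iso v) + sum (λ v → 2 * leaf v))
        ≤⟨ +-mono-≤ sum-need-≤ (≤-reflexive (cong₂ _+_
             (trans (sym (*-distribˡ-sum 8 iso)) (cong (8 *_) (sym (length-filter-tabulate (isolated? G) (λ v → v)))))
             (sym (*-distribˡ-sum 2 leaf)))) ⟩
      6 * length (E G) + (8 * #isolated + 2 * #leaves)    ∎
      where
      open ≤-Reasoning

      iso leaf : Fin n → ℕ
      iso v  = ⟦ does (isolated? G v) ⟧
      leaf v = ⟦ does (degree G v ≟ 1) ⟧

      pointwise : ∀ v → 8 ≤ need (degree G v) + (8 * iso v + 2 * leaf v)
      pointwise v = by-degree (degree G v) refl
        where
        by-degree : ∀ d → degree G v ≡ d → 8 ≤ need d + (8 * iso v + 2 * ⟦ does (d ≟ 1) ⟧)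
        by-degree 0 d≡ rewrite dec-true (isolated? G v) (degree≡0⇒isolated d≡) = ≤-refl
        by-degree 1 d≡ = +-monoʳ-≤ 6 (m≤n+m 2 (8 * iso v))
        by-degree (suc (suc d)) d≡ = m≤m+n 8 _

-- Facial walks

iterate-fixed : ∀ {A : Set} (f : A → A) {x} → f x ≡ x → ∀ k → iterate f x k ≡ x
iterate-fixed f fx≡x zero    = refl
iterate-fixed f fx≡x (suc k) = trans (cong (λ y → iterate f y k) fx≡x) (iterate-fixed f fx≡x k)

iterate-involutive : ∀ {A : Set} (f : A → A) {x} → f (f x) ≡ x → ∀ k →
                     iterate f x k ≡ x ⊎ iterate f x k ≡ f x
iterate-involutive f ffx≡x 0             = inj₁ refl
iterate-involutive f ffx≡x 1             = inj₂ refl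
iterate-involutive f ffx≡x (suc (suc k)) rewrite ffx≡x = iterate-involutive f ffx≡x k

module _ {n : ℕ} (G : Graph n) where

  target : Dart G → Fin n
  target ((_ , v) , _) = v

  src : Dart G → Fin n
  src = source {G = G}

  rev : Dart G → Dart G
  rev = reverse {G = G}

  dart-adj : ∀ d → Adj G (src d) (target d)
  dart-adj = proj₂

  dart-≡ : ∀ {d e : Dart G} → proj₁ d ≡ proj₁ e → d ≡ e
  dart-≡ {_ , a} {_ , b} refl = cong (_ ,_) (T-irrelevant a b)

  degree-≤ : ∀ {v} xs → (∀ x → Adj G v x → x ∈ˡ xs) → degree G v ≤ length xs
  degree-≤ {v} xs ⊆xs = unique-⊆⇒length-≤ (Unique.filter⁺ (Adj? G v) (Unique.allFin⁺ n))
                                          (⊆xs _ ∘ ∈-neighbours⁻ G)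

  degree≡1⇒unique : ∀ {v x y} → degree G v ≡ 1 → Adj G v x → Adj G v y → x ≡ y
  degree≡1⇒unique {v} deg v~x v~y with neighbours G v | ∈-neighbours G v~x | ∈-neighbours G v~y
  ... | _ ∷ [] | here refl | here refl = refl
  degree≡1⇒unique () _ _ | _ ∷ _ ∷ _ | _ | _

  degree-≥1 : ∀ {v x} → Adj G v x → 1 ≤ degree G v
  degree-≥1 {v} v~x with neighbours G v | ∈-neighbours G v~x
  ... | _ ∷ _ | _ = s≤s z≤n

  module _ (embedding : PlanarEmbedding G) (no-light : NoLightPair G) where

    open PlanarEmbedding embedding

    private
      rot : Dart G → Dart G
      rot = Inverse.to rotation

      face : Dart G → Fin #faces
      face = proj₁ faces

    face-next : ∀ d → face (nextOnFace d) ≡ face d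
    face-next d = sym (Equivalence.from (proj₂ (proj₂ faces) d (nextOnFace d)) (1 , refl))

    -- The rotation reaches every dart at the vertex from `d`, so a fixed dart is the only one
    -- there. In the same way, a dart that comes back after two rotations leaves room for at most
    -- two.
    rotation-fixed⇒degree-≤1 : ∀ d → rot d ≡ d → degree G (src d) ≤ 1
    rotation-fixed⇒degree-≤1 d rot≡ = degree-≤ (target d ∷ []) λ x v~x →
      let k , eq = rotation-cyclic d ((src d , x) , v~x) refl
      in here (cong target (trans (sym eq) (iterate-fixed rot rot≡ k)))

    rotation-involutive⇒degree-≤2 : ∀ d → rot (rot d) ≡ d → degree G (src d) ≤ 2
    rotation-involutive⇒degree-≤2 d rot≡ = degree-≤ (target d ∷ target (rot d) ∷ []) λ x v~x →
      let k , eq = rotation-cyclic d ((src d , x) , v~x) refl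
      in case iterate-involutive rot rot≡ k of λ where
        (inj₁ eq′) → here (cong target (trans (sym eq) eq′))
        (inj₂ eq′) → there (here (cong target (trans (sym eq) eq′)))

    rotation-at-leaf : ∀ d → degree G (src d) ≡ 1 → rot d ≡ d
    rotation-at-leaf d leaf = dart-≡ (cong₂ _,_ src≡ (degree≡1⇒unique leaf
      (subst (λ v → Adj G v (target (rot d))) src≡ (dart-adj (rot d))) (dart-adj d)))
      where
      src≡ : src (rot d) ≡ src d
      src≡ = rotation-source d

    next-at-leaf : ∀ d → degree G (target d) ≡ 1 → nextOnFace d ≡ rev d
    next-at-leaf d = rotation-at-leaf (rev d)

    next-reverse : ∀ d → nextOnFace (rev d) ≡ rot d
    next-reverse d = cong rot (dart-≡ refl)

    towards-leaf⇒degree-≥4 : ∀ d → degree G (target d) ≡ 1 → 4 ≤ degree G (src d)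
    towards-leaf⇒degree-≥4 d leaf = +-cancelʳ-≤ 1 4 _
      (subst (λ k → 5 ≤ degree G (src d) + k) leaf (adjacent⇒heavy G no-light (dart-adj d)))

    -- The source of `d` has degree at least 4, so rotation moves `d` to a different neighbour. That
    -- neighbour is not a leaf, because two leaves with a common neighbour form a light pair.
    after-leaf-core : ∀ d → degree G (target d) ≡ 1 → Core G (proj₁ (rot d))
    after-leaf-core d leaf = dart-adj (rot d) , src≢1 , target≢1
      where
      deg≥4 : 4 ≤ degree G (src d)
      deg≥4 = towards-leaf⇒degree-≥4 d leaf

      src≡ : src (rot d) ≡ src d
      src≡ = rotation-source d

      src≢1 : degree G (src (rot d)) ≢ 1
      src≢1 ≡1 = contradiction (subst (4 ≤_) (trans (cong (degree G) (sym src≡)) ≡1) deg≥4) λ where (s≤s ())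

      v~x : Adj G (src d) (target (rot d))
      v~x = subst (λ v → Adj G v (target (rot d))) src≡ (dart-adj (rot d))

      target≢1 : degree G (target (rot d)) ≢ 1
      target≢1 ≡1 with target d Fin.≟ target (rot d)
      ... | no  ℓ≢x = contradiction
        (subst (5 ≤_) (cong₂ _+_ leaf ≡1) (two-apart⇒heavy G no-light (dart-adj d) v~x ℓ≢x)) λ where (s≤s (s≤s ()))
      ... | yes ℓ≡x = contradiction
        (≤-trans deg≥4 (rotation-fixed⇒degree-≤1 d (dart-≡ (cong₂ _,_ src≡ (sym ℓ≡x))))) λ where (s≤s ())

    CoreDart : Set
    CoreDart = Σ[ d ∈ Dart G ] Core G (proj₁ d)

    -- The facial walk with the excursions to leaves cut out.
    step-spec : ((d , _) : CoreDart) → Σ[ (e , _) ∈ CoreDart ]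
                src e ≡ target d × target e ≢ src d × face e ≡ face d
    step-spec (d , _ , _ , target≢1) with degree G (target (nextOnFace d)) ≟ 1
    ... | no ≢1 = (e , dart-adj e , subst (λ v → degree G v ≢ 1) (sym src≡) target≢1 , ≢1) ,
                  src≡ , target≢ , face-next d
      where
      e : Dart G
      e = nextOnFace d

      src≡ : src e ≡ target d
      src≡ = rotation-source (rev d)

      -- Turning back here would mean that the rotation fixes `rev d`, so that the target of `d`
      -- would be a leaf.
      target≢ : target e ≢ src d
      target≢ eq = target≢1 (≤-antisym (rotation-fixed⇒degree-≤1 (rev d) (dart-≡ (cong₂ _,_ src≡ eq)))
                                       (degree-≥1 (dart-adj (rev d))))
    ... | yes leaf = (rot e , after-leaf-core e leaf) , trans (rotation-source e) src≡ , target≢ , face≡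
      where
      e : Dart G
      e = nextOnFace d

      src≡ : src e ≡ target d
      src≡ = rotation-source (rev d)

      -- After the excursion the walk continues with the second rotation of `rev d`. Turning back
      -- would force degree at most 2 on the neighbour of a leaf, whose degree is at least 4.
      target≢ : target (rot e) ≢ src d
      target≢ eq = contradiction
        (≤-trans (subst (λ v → 4 ≤ degree G v) src≡ (towards-leaf⇒degree-≥4 e leaf))
          (rotation-involutive⇒degree-≤2 (rev d) (dart-≡ (cong₂ _,_ (trans (rotation-source e) src≡) eq))))
        λ where (s≤s (s≤s ()))

      -- `d`, `e`, `rev e` and `rot e` follow one another on the facial walk.
      face≡ : face (rot e) ≡ face d
      face≡ = begin
        face (rot e)               ≡⟨ cong face (next-reverse e) ⟨
        face (nextOnFace (rev e))  ≡⟨ face-next (rev e) ⟩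
        face (rev e)               ≡⟨ cong face (next-at-leaf e leaf) ⟨
        face (nextOnFace e)        ≡⟨ face-next e ⟩
        face e                     ≡⟨ face-next d ⟩
        face d                     ∎
        where open ≡-Reasoning

    step : CoreDart → CoreDart
    step = proj₁ ∘ step-spec

    -- Supplies a starting point for `step` on every face: if the given dart runs to or from a leaf,
    -- the dart that ends the excursion is a core dart of the same face.
    core-on-face : ∀ f → Σ[ (d , _) ∈ CoreDart ] face d ≡ f
    core-on-face f with proj₁ (proj₂ faces) f
    ... | d , d-on-f with degree G (src d) ≟ 1 | degree G (target d) ≟ 1
    ...   | no ≢1    | no ≢1′   = (d , dart-adj d , ≢1 , ≢1′) , d-on-f refl
    ...   | no _     | yes leaf = (rot d , after-leaf-core d leaf) , (begin
      face (rot d)               ≡⟨ cong face (next-reverse d) ⟨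
      face (nextOnFace (rev d))  ≡⟨ face-next (rev d) ⟩
      face (rev d)               ≡⟨ cong face (next-at-leaf d leaf) ⟨
      face (nextOnFace d)        ≡⟨ face-next d ⟩
      face d                     ≡⟨ d-on-f refl ⟩
      f                          ∎)
      where open ≡-Reasoning
    ...   | yes leaf | _        =
      (rot (rev d) , after-leaf-core (rev d) leaf) , trans (face-next d) (d-on-f refl)

    -- Eight core darts on every face

    module _ (girth : GirthAtLeast 8 G) where

      no-return : ∀ (c : CoreDart) k → suc k < 8 → src (proj₁ (fold c step (suc k))) ≢ src (proj₁ c)
      no-return c = girth⇒¬return G girth w w-step w-nonbacktracking
        where
        d : ℕ → Dart G
        d i = proj₁ (fold c step i)

        w : ℕ → Fin n
        w i = src (d i)

        next≡ : ∀ i → w (suc i) ≡ target (d i)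
        next≡ i = proj₁ (proj₂ (step-spec (fold c step i)))

        w-step : ∀ i → Adj G (w i) (w (suc i))
        w-step i = subst (Adj G (w i)) (sym (next≡ i)) (dart-adj (d i))

        w-nonbacktracking : ∀ i → w i ≢ w (2 + i)
        w-nonbacktracking i eq =
          proj₁ (proj₂ (proj₂ (step-spec (fold c step i)))) (trans (sym (next≡ (suc i))) (sym eq))

      face-fold : ∀ c i → face (proj₁ (fold c step i)) ≡ face (proj₁ c)
      face-fold c zero    = refl
      face-fold c (suc i) = trans (proj₂ (proj₂ (proj₂ (step-spec (fold c step i))))) (face-fold c i)

      fold-<-≢ : ∀ c {i j} → i < j → j < 8 → src (proj₁ (fold c step i)) ≢ src (proj₁ (fold c step j))
      fold-<-≢ c {i} {j} i<j j<8 eq with difference i<j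
      ... | o , refl = no-return (fold c step i) o
        (≤-<-trans (≤-trans (m≤m+n (suc o) i) (≤-reflexive (sym (+-suc o i)))) j<8)
        (trans (cong (src ∘ proj₁) (trans (sym (fold-+ c step (suc o) {i}))
                                          (cong (fold c step) (sym (+-suc o i))))) (sym eq))

      -- Eight consecutive darts of the shortened walk are taken on each face. Darts on different
      -- faces differ, and those on one face have different sources by `fold-<-≢`.
      #faces*8≤#core : #faces * 8 ≤ #core G
      #faces*8≤#core = injective⇒≤-length {f = corner} injective λ i →
        ∈-filter⁺ (core? G) (∈-cartesianProduct⁺ (∈-allFin _) (∈-allFin _))
                  (proj₂ (fold (rep (proj₁ (remQuot 8 i))) step (toℕ (proj₂ (remQuot {#faces} 8 i)))))
        where
        rep : Fin #faces → CoreDart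
        rep f = proj₁ (core-on-face f)

        dartAt : Fin #faces × Fin 8 → Dart G
        dartAt (f , i) = proj₁ (fold (rep f) step (toℕ i))

        corner : Fin (#faces * 8) → Pair n
        corner i = proj₁ (dartAt (remQuot 8 i))

        face-dartAt : ∀ f i → face (dartAt (f , i)) ≡ f
        face-dartAt f i = trans (face-fold (rep f) (toℕ i)) (proj₂ (core-on-face f))

        dartAt-injective : ∀ p q → proj₁ (dartAt p) ≡ proj₁ (dartAt q) → p ≡ q
        dartAt-injective (f , i) (g , j) eq
          with trans (sym (face-dartAt f i)) (trans (cong face (dart-≡ eq)) (face-dartAt g j))
        ... | refl with Fin.<-cmp i j
        ...   | tri< i<j _ _  = contradiction (cong proj₁ eq) (fold-<-≢ (rep f) i<j (Fin.toℕ<n j))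
        ...   | tri≈ _ refl _ = refl
        ...   | tri> _ _ j<i  = contradiction (cong proj₁ (sym eq)) (fold-<-≢ (rep f) j<i (Fin.toℕ<n i))

        injective : ∀ {i j} → corner i ≡ corner j → i ≡ j
        injective {i} {j} eq = begin
          i                               ≡⟨ Fin.combine-remQuot {#faces} 8 i ⟨
          uncurry combine (remQuot {#faces} 8 i)
            ≡⟨ cong (uncurry combine) (dartAt-injective (remQuot 8 i) (remQuot 8 j) eq) ⟩
          uncurry combine (remQuot {#faces} 8 j)
            ≡⟨ Fin.combine-remQuot {#faces} 8 j ⟩
          j                               ∎
          where open ≡-Reasoning

    -- The isolated vertices together with the endpoint `a` of an edge lie in pairwise different
    -- components.
    #isolated<#components : ∀ {a b} → Adj G a b → #isolated G < #components
    #isolated<#components {a} {b} a~b = Fin.injective⇒≤ {f = component ∘ List.lookup representatives} λ {i} {j} eq →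
      unique⇒lookup-injective unique (same-component (∈-lookup i) (∈-lookup j) eq)
      where
      isolatedVertices representatives : List (Fin n)
      isolatedVertices = filter (isolated? G) (allFin n)
      representatives  = a ∷ isolatedVertices

      component : Fin n → Fin #components
      component = proj₁ components

      isolated : ∀ {x} → x ∈ˡ isolatedVertices → Isolated G x
      isolated x∈ = proj₂ (∈-filter⁻ (isolated? G) {xs = allFin n} x∈)

      unique : Unique representatives
      unique = ¬Any⇒All¬ _ (λ a∈ → isolated a∈ b a~b) ∷ Unique.filter⁺ (isolated? G) (Unique.allFin⁺ n)

      star-isolated : ∀ {x y} → Isolated G x → Star (Adj G) x y → x ≡ y
      star-isolated iso ε         = refl
      star-isolated iso (x~z ◅ _) = contradiction x~z (iso _)

      same-component : ∀ {x y} → x ∈ˡ representatives → y ∈ˡ representatives → component x ≡ component y → x ≡ y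
      same-component (here refl) (here refl) _ = refl
      same-component (there x∈) _ eq =
        star-isolated (isolated x∈) (Equivalence.to (proj₂ (proj₂ components) _ _) eq)
      same-component (here refl) (there y∈) eq =
        sym (star-isolated (isolated y∈) (Equivalence.to (proj₂ (proj₂ components) _ _) (sym eq)))

    no-light-absurd : GirthAtLeast 8 G → ∀ {a b} → ¬ Adj G a b
    no-light-absurd girth a~b = <⇒≱ (begin-strict
      8 * n + (8 * F + 8 * I)                            ≤⟨ +-monoˡ-≤ (8 * F + 8 * I) (8n≤ G no-light) ⟩
      (6 * M + (8 * I + 2 * L)) + (8 * F + 8 * I)        ≡⟨ regroup M I L F ⟩
      (F * 8 + 2 * L) + (6 * M + 16 * I)
        ≤⟨ +-monoˡ-≤ (6 * M + 16 * I) (≤-trans (+-monoˡ-≤ (2 * L) (#faces*8≤#core girth)) (#core+2#leaves≤2#E G no-light)) ⟩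
      2 * M + (6 * M + 16 * I)                           ≡⟨ collect M I ⟩
      16 * I + 8 * M                                     <⟨ +-monoˡ-< (8 * M) (*-monoʳ-< 16 (#isolated<#components a~b)) ⟩
      16 * #components + 8 * M                           ≡⟨ split #components M ⟩
      8 * (2 * #components + M)                          ∎)
      (≤-reflexive (trans (cong (8 *_) (sym genus-zero)) (distribute n F I)))
      where
      open ≤-Reasoning
      F = #faces
      I = #isolated G
      L = #leaves G
      M = length (E G)

      regroup : ∀ M I L F → (6 * M + (8 * I + 2 * L)) + (8 * F + 8 * I) ≡ (F * 8 + 2 * L) + (6 * M + 16 * I)
      regroup = solve-∀

      collect : ∀ M I → 2 * M + (6 * M + 16 * I) ≡ 16 * I + 8 * M
      collect = solve-∀

      split : ∀ C M → 16 * C + 8 * M ≡ 8 * (2 * C + M)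
      split = solve-∀

      distribute : ∀ n F I → 8 * (n + (F + I)) ≡ 8 * n + (8 * F + 8 * I)
      distribute = solve-∀

-- Light pairs in planar graphs and the algorithm

planar⇒light : ∀ {n} (G : Graph n) → Planar G → GirthAtLeast 8 G → ∀ {a b} → Adj G a b →
               ∃[ u ] ∃[ v ] ∃[ w ] LightPair G u v w
planar⇒light G planar girth a~b = decidable-stable (lightPair? G) λ none →
  no-light-absurd G planar (λ u v w light → none (u , v , w , light)) girth a~b

proposition1p3 : EdgeSetFoundInPolynomialTime
    (λ G → Planar G × GirthAtLeast 8 G × 3 ≤ length (E G))
    (λ G E′ → length E′ ≡ 3 × γ (G ─ E′) > γ G)
proposition1p3 = separation⇒polynomial-time
  (λ G → Planar G × GirthAtLeast 8 G × 3 ≤ length (E G))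
  λ G (planar , girth , 3≤∣E∣) →
    let a , b , a~b                         = nonempty⇒adjacent G (≤-trans (s≤s z≤n) 3≤∣E∣)
        u , v , w , light                   = planar⇒light G planar girth a~b
        e₁ , e₂ , e₃ , unique , E′⊆E , sep  = light⇒separates G light 3≤∣E∣
    in e₁ , e₂ , e₃ , u , v , w , unique , (λ {x} → E′⊆E {x}) , sep
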